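{- Let $(\mathcal{P},\omega)$ be an oriented partition of the connected graph $G$ into $t$ classes, with signed cycle–class matrix $A\in\mathbb{Z}^{c\times t}$. Then: (i) The most generic consistent generator assignment takes values in the finitely generated abelian group $\Gamma_{\mathrm{univ}}=\mathbb{Z}^t/\mathrm{rowlattice}(A)$, with $g_j$ the image of the $j$-th standard basis vector; every consistent assignment in any abelian group is a homomorphic image of it. (ii) The Smith Normal Form computes it: if $UA^{\top}W=\mathrm{diag}(d_1,\dots,d_\rho,0,\dots)$ with $U,W$ unimodular, then $\Gamma_{\mathrm{univ}}\cong\mathbb{Z}_{d_1}\times\cdots\times\mathbb{Z}_{d_\rho}\times\mathbb{Z}^{t-\rho}$ (factors with $d_i=1$ trivial), and the coordinates of $g_j$ are read off the $j$-th column of $U$, reduced modulo $d_i$ in the torsion coordinates. (iii) Let $\phi$ be the labeling of $V(G)$ induced by this assignment. With $S=\{\pm g_j: g_j\neq0\}$, every path of length $\ell$ in $G$ maps under $\phi$ to a walk of length $\ell$ in the Cayley graph $\mathrm{Cay}(\Gamma_{\mathrm{univ}},S)$, hence $d_{\mathrm{Cay}}(\phi(u),\phi(v))\leq d_G(u,v)$ for all pairs $u,v$: the only possible failure of isometry is a shortcut (a pair with $d_{\mathrm{Cay}}(\phi(u),\phi(v))<d_G(u,v)$).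
   Context: Graphs are finite, simple, connected and undirected; $d_G$ is the shortest-path distance. An oriented partition of $G$ is a partition $\mathcal{P}=\{F_1,\dots,F_t\}$ of $E(G)$ together with a chosen (forward) direction, recorded by $\omega$, of every edge; $\mathrm{class}(e)=j$ means $e\in F_j$. An assignment $g_1,\dots,g_t$ of elements of an abelian group to the classes is consistent if for every cycle of $G$, traversed in a fixed rotational sense, the sum of $\pm g_{\mathrm{class}(e)}$ over its edges ($+$ if traversed forward, $-$ if backward) is $0$. A consistent assignment $(g'_1,\dots,g'_t)$ in an abelian group $\Gamma$ is a homomorphic image of $(g_1,\dots,g_t)$ in $\Gamma_{\mathrm{univ}}$ if there is a homomorphism $\Gamma_{\mathrm{univ}}\to\Gamma$ with $g_j\mapsto g'_j$ for all $j$. The labeling induced by an assignment is $\phi(v)=\sum_{e\in P(r,v)}\pm g_{\mathrm{class}(e)}$, summed along a path $P(r,v)$ from a root $r$ to $v$ with the same sign rule. For a cycle basis $B_1,\dots,B_c$ of $G$ (each cycle traversed in a fixed sense), $A[i,j]$ is the net signed number of crossings of $F_j$ by $B_i$ (forward traversals $+1$, backward $-1$). $\mathrm{rowlattice}(A)$ is the subgroup of $\mathbb{Z}^t$ generated by the rows of $A$; $\rho=\mathrm{rank}(A)$. $\mathrm{Cay}(\Gamma,S)$ is the graph on $\Gamma$ with edges $\{g,g+s\}$, $s\in S$; $d_{\mathrm{Cay}}$ is its shortest-path distance.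
   Formalization: A cycle basis is taken to be a ℤ-basis of the integral cycle lattice, since otherwise (i) can fail; in (iii) an edge whose class has g_j = 0 gives a stationary step, so a path maps to a genuine Cayley walk of length ℓ only if all its classes have g_j ≠ 0. -}

module Defs where

open import Level using (Level; 0ℓ; _⊔_)
open import Algebra.Bundles using (AbelianGroup)
import Algebra.Construct.DirectProduct as DirectProduct
import Algebra.Construct.Pointwise as Pointwise
open import Algebra.Morphism.Structures using (module GroupMorphisms)
import Algebra.Properties.AbelianGroup as AbelianGroupProperties
import Algebra.Properties.Group as GroupProperties
open import Data.Bool.Base using (Bool; true; false; if_then_else_; not)
open import Data.Fin.Base using (Fin; zero; suc; toℕ; punchIn; inject≤; cast; _↑ʳ_)
open import Data.Fin.Properties using (_≟_)
open import Data.Integer.Base as ℤ using (ℤ; +_; 0ℤ; 1ℤ; -1ℤ)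
import Data.Integer.Properties as ℤ
open import Algebra.Properties.Semiring.Sum ℤ.+-*-semiring using (sum)
open import Data.List.Base using (List; []; _∷_)
open import Data.List.Relation.Unary.Unique.Propositional using (Unique)
open import Data.Nat.Base as ℕ using (ℕ; zero; suc; _∸_)
import Data.Nat.Properties as ℕ
open import Data.Product.Base using (Σ; ∃; _×_; _,_)
open import Data.Sum.Base using (_⊎_)
open import Data.Vec.Functional using (Vector)
open import Function.Base using (_∘_)
open import Relation.Binary.Construct.Closure.ReflexiveTransitive using (Star; _◅_) renaming (ε to nil)
open import Relation.Binary.Core using (Rel)
open import Relation.Binary.Definitions using (Symmetric; Irreflexive; Irrelevant; Decidable)
open import Relation.Binary.PropositionalEquality.Core using (_≡_)
import Relation.Binary.Reasoning.Setoid as SetoidReasoning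
open import Relation.Nullary.Decidable.Core using (Dec; does; _×-dec_)
open import Relation.Nullary.Negation.Core using (¬_)
open import Relation.Unary using (Pred)

private
  variable
    a b ℓ p : Level
    k m n ρ : ℕ

module _ (Γ : AbelianGroup a ℓ) where

  open AbelianGroup Γ

  data ⟨_⟩ (P : Pred Carrier p) : Pred Carrier (a ⊔ ℓ ⊔ p) where
    gen       : ∀ {x} → P x → ⟨_⟩ P x
    ε∈        : ⟨_⟩ P ε
    ∙-closed  : ∀ {x y} → ⟨_⟩ P x → ⟨_⟩ P y → ⟨_⟩ P (x ∙ y)
    ⁻¹-closed : ∀ {x} → ⟨_⟩ P x → ⟨_⟩ P (x ⁻¹)
    resp      : ∀ {x y} → x ≈ y → ⟨_⟩ P x → ⟨_⟩ P y

  Generates : Vector Carrier n → Set (a ⊔ ℓ)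
  Generates g = ∀ x → ⟨_⟩ (λ y → ∃ λ j → y ≈ g j) x

  -- The quotient of Γ by the subgroup generated by P.
  quotient : Pred Carrier p → AbelianGroup a (a ⊔ ℓ ⊔ p)
  quotient P = record
    { Carrier = Carrier
    ; _≈_     = _∼_
    ; _∙_     = _∙_
    ; ε       = ε
    ; _⁻¹     = _⁻¹
    ; isAbelianGroup = record
      { isGroup = record
        { isMonoid = record
          { isSemigroup = record
            { isMagma = record
              { isEquivalence = record
                { refl  = ≈⇒∼ refl
                ; sym   = λ {x} {y} h → resp (⁻¹-anti-homo‿- x y) (⁻¹-closed h)
                ; trans = λ {x} {y} {z} h₁ h₂ →
                    resp (telescope x y z) (∙-closed h₁ h₂)
                }
              ; ∙-cong = λ {x} {y} {u} {v} h₁ h₂ →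
                  resp (interchange x y u v) (∙-closed h₁ h₂)
              }
            ; assoc = λ x y z → ≈⇒∼ (assoc x y z)
            }
          ; identity = (λ x → ≈⇒∼ (identityˡ x)) , (λ x → ≈⇒∼ (identityʳ x))
          }
        ; inverse = (λ x → ≈⇒∼ (inverseˡ x)) , (λ x → ≈⇒∼ (inverseʳ x))
        ; ⁻¹-cong = λ {x} {y} h →
            resp (sym (⁻¹-∙-comm x (y ⁻¹))) (⁻¹-closed h)
        }
      ; comm = λ x y → ≈⇒∼ (comm x y)
      }
    }
    where
    open AbelianGroupProperties Γ
    open SetoidReasoning setoid

    _∼_ : Rel Carrier _
    x ∼ y = ⟨_⟩ P (x ∙ y ⁻¹)

    ≈⇒∼ : ∀ {x y} → x ≈ y → x ∼ y
    ≈⇒∼ x≈y = resp (sym (x≈y⇒x∙y⁻¹≈ε x≈y)) ε∈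

    telescope : ∀ x y z → (x ∙ y ⁻¹) ∙ (y ∙ z ⁻¹) ≈ x ∙ z ⁻¹
    telescope x y z = begin
      (x ∙ y ⁻¹) ∙ (y ∙ z ⁻¹)  ≈⟨ assoc x (y ⁻¹) (y ∙ z ⁻¹) ⟩
      x ∙ (y ⁻¹ ∙ (y ∙ z ⁻¹))  ≈⟨ ∙-congˡ (sym (assoc (y ⁻¹) y (z ⁻¹))) ⟩
      x ∙ ((y ⁻¹ ∙ y) ∙ z ⁻¹)  ≈⟨ ∙-congˡ (∙-congʳ (inverseˡ y)) ⟩
      x ∙ (ε ∙ z ⁻¹)           ≈⟨ ∙-congˡ (identityˡ (z ⁻¹)) ⟩
      x ∙ z ⁻¹                 ∎

    interchange : ∀ x y u v → (x ∙ y ⁻¹) ∙ (u ∙ v ⁻¹) ≈ (x ∙ u) ∙ (y ∙ v) ⁻¹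
    interchange x y u v = begin
      (x ∙ y ⁻¹) ∙ (u ∙ v ⁻¹)  ≈⟨ assoc x (y ⁻¹) (u ∙ v ⁻¹) ⟩
      x ∙ (y ⁻¹ ∙ (u ∙ v ⁻¹))  ≈⟨ ∙-congˡ (sym (assoc (y ⁻¹) u (v ⁻¹))) ⟩
      x ∙ ((y ⁻¹ ∙ u) ∙ v ⁻¹)  ≈⟨ ∙-congˡ (∙-congʳ (comm (y ⁻¹) u)) ⟩
      x ∙ ((u ∙ y ⁻¹) ∙ v ⁻¹)  ≈⟨ ∙-congˡ (assoc u (y ⁻¹) (v ⁻¹)) ⟩
      x ∙ (u ∙ (y ⁻¹ ∙ v ⁻¹))  ≈⟨ sym (assoc x u (y ⁻¹ ∙ v ⁻¹)) ⟩
      (x ∙ u) ∙ (y ⁻¹ ∙ v ⁻¹)  ≈⟨ ∙-congˡ (⁻¹-∙-comm y v) ⟩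
      (x ∙ u) ∙ (y ∙ v) ⁻¹     ∎

Π : {I : Set b} → (I → AbelianGroup a ℓ) → AbelianGroup (b ⊔ a) (b ⊔ ℓ)
Π {I = I} Γ = record
  { Carrier = ∀ i → Γ.Carrier i
  ; _≈_     = λ x y → ∀ i → Γ._≈_ i (x i) (y i)
  ; _∙_     = λ x y i → Γ._∙_ i (x i) (y i)
  ; ε       = λ i → Γ.ε i
  ; _⁻¹     = λ x i → Γ._⁻¹ i (x i)
  ; isAbelianGroup = record
    { isGroup = record
      { isMonoid = record
        { isSemigroup = record
          { isMagma = record
            { isEquivalence = record
              { refl  = λ i → Γ.refl i
              ; sym   = λ h i → Γ.sym i (h i)
              ; trans = λ h₁ h₂ i → Γ.trans i (h₁ i) (h₂ i)
              }
            ; ∙-cong = λ h₁ h₂ i → Γ.∙-cong i (h₁ i) (h₂ i)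
            }
          ; assoc = λ x y z i → Γ.assoc i (x i) (y i) (z i)
          }
        ; identity = (λ x i → Γ.identityˡ i (x i)) , (λ x i → Γ.identityʳ i (x i))
        }
      ; inverse = (λ x i → Γ.inverseˡ i (x i)) , (λ x i → Γ.inverseʳ i (x i))
      ; ⁻¹-cong = λ h i → Γ.⁻¹-cong i (h i)
      }
    ; comm = λ x y i → Γ.comm i (x i) (y i)
    }
  }
  where module Γ (i : I) = AbelianGroup (Γ i)

ℤ^ : ℕ → AbelianGroup 0ℓ 0ℓ
ℤ^ n = Pointwise.abelianGroup (Fin n) ℤ.+-0-abelianGroup

ℤ/ : ℕ → AbelianGroup 0ℓ 0ℓ
ℤ/ d = quotient ℤ.+-0-abelianGroup (λ x → x ≡ + d)

_×ᴳ_ : AbelianGroup a ℓ → AbelianGroup b p → AbelianGroup (a ⊔ b) (ℓ ⊔ p)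
_×ᴳ_ = DirectProduct.abelianGroup

module _ (Γ : AbelianGroup a ℓ) (Δ : AbelianGroup b p) where

  private
    module Γ = AbelianGroup Γ
    module Δ = AbelianGroup Δ
  open GroupMorphisms Γ.rawGroup Δ.rawGroup public
    using () renaming (IsGroupHomomorphism to IsHom; IsGroupIsomorphism to IsIso)

  IsHomomorphicImage : Vector Γ.Carrier n → Vector Δ.Carrier n → Set (a ⊔ b ⊔ ℓ ⊔ p)
  IsHomomorphicImage g g′ = ∃ λ f → IsHom f × ∀ j → f (g j) Δ.≈ g′ j

Matrix : ℕ → ℕ → Set
Matrix m n = Vector (Vector ℤ n) m

infixl 7 _⊗_

_⊗_ : Matrix m k → Matrix k n → Matrix m n
(M ⊗ N) i j = sum λ l → M i l ℤ.* N l j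

infix 9 _ᵀ

_ᵀ : Matrix m n → Matrix n m
(M ᵀ) i j = M j i

infix 4 _≋_

_≋_ : Rel (Matrix m n) 0ℓ
M ≋ N = ∀ i j → M i j ≡ N i j

-- Laplace expansion along the first row.
det : Matrix n n → ℤ
det {zero}  M = 1ℤ
det {suc n} M = sum λ j →
  (-1ℤ ℤ.^ toℕ j) ℤ.* M zero j ℤ.* det λ i k → M (suc i) (punchIn j k)

Unimodular : Matrix n n → Set
Unimodular M = ℤ.∣ det M ∣ ≡ 1

-- The m × n matrix with d₁, …, d_ρ on the diagonal and 0 elsewhere; entries
-- that would fall outside are dropped, so it is used with ρ ≤ m and ρ ≤ n.
diag : Vector ℕ ρ → Matrix m n
diag {zero}  d i       j       = 0ℤ
diag {suc ρ} d zero    zero    = + d zero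
diag {suc ρ} d zero    (suc j) = 0ℤ
diag {suc ρ} d (suc i) zero    = 0ℤ
diag {suc ρ} d (suc i) (suc j) = diag (d ∘ suc) i j

-- Over ℤ; for integer vectors this is the same as independence over ℚ.
LinearlyIndependent : {X : Set a} → Vector (X → ℤ) n → Set a
LinearlyIndependent {n = n} {X} v =
  ∀ (z : Vector ℤ n) → (∀ (x : X) → sum (λ i → z i ℤ.* v i x) ≡ 0ℤ) → ∀ i → z i ≡ 0ℤ

-- ρ is the maximal number of linearly independent rows.
IsRank : Matrix m n → ℕ → Set
IsRank {m} A ρ =
  (∃ λ (s : Vector (Fin m) ρ) → LinearlyIndependent (λ i → A (s i))) ×
  (∀ k (s : Vector (Fin m) k) → LinearlyIndependent (λ i → A (s i)) → k ℕ.≤ ρ)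

ℤ^t/rowlattice : ∀ {t} → Matrix m t → AbelianGroup 0ℓ 0ℓ
ℤ^t/rowlattice {t = t} A = quotient (ℤ^ t) (λ x → ∃ λ i → ∀ j → x j ≡ A i j)

indicator : {P : Set p} → Dec P → ℤ
indicator P? = if does P? then 1ℤ else 0ℤ

basisVector : Fin n → Vector ℤ n
basisVector j k = indicator (j ≟ k)

-- Positions of the torsion coordinates 0, …, ρ-1 and of the free coordinates
-- ρ, …, t-1 among all t coordinates.
torsionIndex : ∀ {t} → ρ ℕ.≤ t → Fin ρ → Fin t
torsionIndex ρ≤t i = inject≤ i ρ≤t

freeIndex : ∀ {t} → ρ ℕ.≤ t → Fin (t ∸ ρ) → Fin t
freeIndex {ρ} ρ≤t i = cast (ℕ.m+[n∸m]≡n ρ≤t) (ρ ↑ʳ i)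

record Graph : Set₁ where
  infix 4 _~_
  field
    order        : ℕ
    _~_          : Rel (Fin order) 0ℓ
    ~-sym        : Symmetric _~_
    ~-irrefl     : Irreflexive _≡_ _~_
    ~-dec        : Decidable _~_
    -- There is at most one edge between two vertices.
    ~-irrelevant : Irrelevant _~_

  V : Set
  V = Fin order

  Walk : Rel V 0ℓ
  Walk = Star _~_

  length : ∀ {u v} → Walk u v → ℕ
  length nil     = 0
  length (_ ◅ w) = suc (length w)

  vertices : ∀ {u v} → Walk u v → List V
  vertices {u} nil     = u ∷ []
  vertices {u} (_ ◅ w) = u ∷ vertices w

  -- All vertices of the walk except its endpoint.
  sources : ∀ {u v} → Walk u v → List V
  sources nil         = []
  sources {u} (_ ◅ w) = u ∷ sources w

  IsPath : ∀ {u v} → Walk u v → Set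
  IsPath w = Unique (vertices w)

  Connected : Set
  Connected = ∀ u v → Walk u v

  -- A cycle, with a starting vertex and a rotational sense.
  record Cycle : Set where
    field
      {base}   : V
      walk     : Walk base base
      simple   : Unique (sources walk)
      3≤length : 3 ℕ.≤ length walk

  -- The signed incidence vector in the edge space: (x , y) ↦ the number of
  -- traversals from x to y minus the number of traversals from y to x.
  flow : ∀ {u v} → Walk u v → V × V → ℤ
  flow nil _ = 0ℤ
  flow (_◅_ {u} {v} _ w) (x , y) =
    indicator ((u ≟ x) ×-dec (v ≟ y)) ℤ.- indicator ((u ≟ y) ×-dec (v ≟ x))
      ℤ.+ flow w (x , y)

  -- A basis, over ℤ, of the lattice generated by the cycles. (Over a field of
  -- coefficients instead, the cycles of a basis need not generate all the
  -- cycles with integer coefficients.)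
  record IsCycleBasis {c} (B : Vector Cycle c) : Set where
    field
      independent : LinearlyIndependent (λ i → flow (Cycle.walk (B i)))
      spanning    : ∀ (C : Cycle) → ∃ λ (z : Vector ℤ c) →
        ∀ e → flow (Cycle.walk C) e ≡ sum λ i → z i ℤ.* flow (Cycle.walk (B i)) e

-- An undirected edge is the pair of its two orientations e and ~-sym e;
-- exactly one of them is forward.
record OrientedPartition (G : Graph) (t : ℕ) : Set where
  open Graph G
  field
    class       : ∀ {u v} → u ~ v → Fin t
    class-sym   : ∀ {u v} (e : u ~ v) → class (~-sym e) ≡ class e
    nonempty    : ∀ j → ∃ λ u → ∃ λ v → Σ (u ~ v) λ e → class e ≡ j
    forward     : ∀ {u v} → u ~ v → Bool
    forward-sym : ∀ {u v} (e : u ~ v) → forward (~-sym e) ≡ not (forward e)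

  classes : ∀ {u v} → Walk u v → List (Fin t)
  classes nil     = []
  classes (e ◅ w) = class e ∷ classes w

  crossings : ∀ {u v} → Walk u v → Fin t → ℤ
  crossings nil     j = 0ℤ
  crossings (e ◅ w) j =
    (if forward e then 1ℤ else -1ℤ) ℤ.* indicator (class e ≟ j) ℤ.+ crossings w j

  cycleClassMatrix : ∀ {c} → Vector Cycle c → Matrix c t
  cycleClassMatrix B i j = crossings (Cycle.walk (B i)) j

  module _ (Γ : AbelianGroup a ℓ) where

    private
      module Γ = AbelianGroup Γ

    signedSum : Vector Γ.Carrier t → ∀ {u v} → Walk u v → Γ.Carrier
    signedSum g nil     = Γ.ε
    signedSum g (e ◅ w) =
      (if forward e then g (class e) else g (class e) Γ.⁻¹) Γ.∙ signedSum g w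

    Consistent : Vector Γ.Carrier t → Set ℓ
    Consistent g = ∀ (C : Cycle) → signedSum g (Cycle.walk C) Γ.≈ Γ.ε

-- WalkAlong _≈_ _⇝_ xs x y n: the sequence xs is a walk of n steps from x to
-- y, consecutive members being related by _⇝_ (vertices being equal up to _≈_).
data WalkAlong {A : Set a} (_≈_ : Rel A ℓ) (_⇝_ : Rel A p) :
               List A → A → A → ℕ → Set (a ⊔ ℓ ⊔ p) where
  stop : ∀ {x y} → x ≈ y → WalkAlong _≈_ _⇝_ (x ∷ []) x y 0
  step : ∀ {x y z xs n} → x ⇝ y → WalkAlong _≈_ _⇝_ (y ∷ xs) y z n →
         WalkAlong _≈_ _⇝_ (x ∷ y ∷ xs) x z (suc n)

IsLeast : Pred ℕ p → Pred ℕ p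
IsLeast P n = P n × (∀ k → P k → n ℕ.≤ k)

module _ (G : Graph) where

  open Graph G

  IsDistance : V → V → ℕ → Set
  IsDistance u v = IsLeast λ n → Σ (Walk u v) λ w → length w ≡ n

module Cayley (Γ : AbelianGroup a ℓ) (S : Pred (AbelianGroup.Carrier Γ) p) where

  open AbelianGroup Γ

  Adjacent : Rel Carrier (a ⊔ ℓ ⊔ p)
  Adjacent x y = ∃ λ s → S s × (y ≈ x ∙ s ⊎ x ≈ y ∙ s)

  CayleyWalk : List Carrier → Carrier → Carrier → ℕ → Set (a ⊔ ℓ ⊔ p)
  CayleyWalk = WalkAlong _≈_ Adjacent

  -- A step of a lazy walk may also stay in place. Equality in Γ need not be
  -- decided to say so: consecutive members are adjacent unless equal.
  LazyWalk : List Carrier → Carrier → Carrier → ℕ → Set (a ⊔ ℓ ⊔ p)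
  LazyWalk = WalkAlong _≈_ (λ x y → ¬ (x ≈ y) → Adjacent x y)

  IsCayleyDistance : Carrier → Carrier → ℕ → Set (a ⊔ ℓ ⊔ p)
  IsCayleyDistance x y = IsLeast λ n → ∃ λ xs → CayleyWalk xs x y n

connectionSet : (Γ : AbelianGroup a ℓ) → Vector (AbelianGroup.Carrier Γ) n →
                Pred (AbelianGroup.Carrier Γ) ℓ
connectionSet Γ g s = ∃ λ j → ¬ (g j ≈ Γ.ε) × (s ≈ g j ⊎ s ≈ g j ⁻¹)
  where
  module Γ = AbelianGroup Γ
  open Γ using (_≈_; _⁻¹)

{-# OPTIONS --safe #-}

-- (i) Crossing numbers are linear in the flow of a walk, so the crossing vector
-- of every cycle lies in the lattice spanned by the rows of A, and an assignment
-- is consistent as soon as it kills these rows.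
--
-- (ii) The isomorphism is x ↦ U x. A Laplace determinant is multilinear and
-- alternating in the rows, so a unimodular matrix has a right inverse; it is
-- injective because m + 1 integer vectors in ℤᵐ are dependent. Since
-- U Aᵀ W = diag d, the map U carries rowlattice(A) = Aᵀ ℤᶜ onto diag(d) ℤᶜ.
--
-- (iii) Erasing loops turns a walk into a path with the same signed sum, since
-- each erased loop is a cycle or a backtrack. Hence signed sums depend only on
-- the endpoints, and along an edge φ changes by ± the generator of its class.
module Submission where

open import Defs
open import Algebra.Bundles using (AbelianGroup)
import Algebra.Properties.AbelianGroup as AbelianGroupProperties
import Algebra.Properties.CommutativeMonoid.Mult as Mult
import Algebra.Properties.CommutativeMonoid.Sum as Sum
open import Data.Bool.Base using (true; false; if_then_else_)
open import Data.Fin.Base as Fin using (Fin; zero; suc; toℕ; punchIn; inject₁)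
open import Data.Fin.Properties using (_≟_; any?; toℕ-inject₁; cast-is-id)
open import Data.Integer.Base as ℤ
  using (ℤ; 0ℤ; 1ℤ; -1ℤ; _+_; _*_; -_; _-_; _^_; _⊖_; ∣_∣)
import Data.Integer.Properties as ℤ
open import Algebra.Properties.Semiring.Sum ℤ.+-*-semiring
  using ( sum; sum-syntax; sum-cong-≗; sum-replicate-zero; sum-remove
        ; ∑-distrib-+; ∑-comm; *-distribˡ-sum; *-distribʳ-sum)
open import Data.Integer.Tactic.RingSolver using (solve-∀)
open import Data.List.Base using (map)
open import Data.List.Membership.Propositional using (_∈_)
open import Data.List.Relation.Unary.All using (All; []; _∷_; lookup)
open import Data.List.Relation.Unary.All.Properties using (¬Any⇒All¬)
open import Data.List.Relation.Unary.AllPairs using ([]; _∷_)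
import Data.List.Relation.Unary.Any as Any
open import Data.List.Relation.Unary.Any using (here; there)
open import Data.List.Relation.Unary.Unique.Propositional using (Unique)
open import Data.Nat.Base as ℕ using (ℕ; zero; suc; _≤_; _<_; _∸_; z≤n; s≤s)
open import Data.Nat.Induction using (<-rec)
import Data.Nat.Properties as ℕ
open import Data.Product.Base using (∃; _×_; _,_; proj₁; proj₂)
open import Data.Sum.Base using (_⊎_; inj₁; inj₂)
open import Data.Vec.Functional using (Vector; tail; updateAt; insertAt) renaming ([] to []ᵛ; _∷_ to _∷ᵛ_)
open import Data.Vec.Functional.Properties
  using ( updateAt-updates; updateAt-minimal; updateAt-id-local; map-updateAt
        ; insertAt-lookup; insertAt-punchIn)
open import Function.Base using (_∘_; const; _$_)
open import Level using (Level; 0ℓ)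
open import Relation.Binary.Construct.Closure.ReflexiveTransitive
  using (_◅_; _◅◅_) renaming (ε to nil)
open import Relation.Binary.PropositionalEquality
  using (_≡_; _≢_; _≗_; refl; sym; trans; cong; cong₂; subst; module ≡-Reasoning)
import Relation.Binary.Reasoning.Setoid as SetoidReasoning
open import Relation.Nullary.Decidable using (Dec; yes; no; ¬?; _×-dec_; decidable-stable)
open import Relation.Nullary.Negation using (¬_; contradiction)
open import Relation.Unary using (Pred)

private
  variable
    a b ℓ ℓ′ p q : Level
    k m n t ρ : ℕ

-- Sums of integers

sum-zero : (v : Vector ℤ n) → (∀ i → v i ≡ 0ℤ) → sum v ≡ 0ℤ
sum-zero {n} v v≗0 = trans (sum-cong-≗ v≗0) (sum-replicate-zero n)

sum-linear : ∀ x y (u v : Vector ℤ n) →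
             ∑[ i < n ] (x * u i + y * v i) ≡ x * sum u + y * sum v
sum-linear x y u v =
  trans (∑-distrib-+ (λ i → x * u i) (λ i → y * v i))
        (sym (cong₂ _+_ (*-distribˡ-sum x u) (*-distribˡ-sum y v)))

sum-basisVector : ∀ (j : Fin n) v → ∑[ i < n ] (v i * basisVector j i) ≡ v j
sum-basisVector {suc n} zero v = begin
  v zero * 1ℤ + ∑[ i < n ] (v (suc i) * 0ℤ)
    ≡⟨ cong₂ _+_ (ℤ.*-identityʳ (v zero)) (sum-zero _ λ i → ℤ.*-zeroʳ (v (suc i))) ⟩
  v zero + 0ℤ
    ≡⟨ ℤ.+-identityʳ _ ⟩
  v zero ∎
  where open ≡-Reasoning
sum-basisVector {suc n} (suc j) v =
  trans (cong₂ _+_ (ℤ.*-zeroʳ (v zero)) (sum-basisVector j (tail v))) (ℤ.+-identityˡ _)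

basisVector-sym : ∀ (i j : Fin n) → basisVector i j ≡ basisVector j i
basisVector-sym zero    zero    = refl
basisVector-sym zero    (suc j) = refl
basisVector-sym (suc i) zero    = refl
basisVector-sym (suc i) (suc j) = basisVector-sym i j

-- Determinants

det-cong : {M N : Matrix n n} → M ≋ N → det M ≡ det N
det-cong {zero}  M≋N = refl
det-cong {suc n} M≋N = sum-cong-≗ λ j →
  cong₂ (λ x y → (-1ℤ ^ toℕ j) * x * y) (M≋N zero j) (det-cong λ i k → M≋N (suc i) (punchIn j k))

minor : Fin (suc n) → Matrix (suc n) (suc n) → Matrix n n
minor j M i k = M (suc i) (punchIn j k)

infixl 10 _[_≔_]

_[_≔_] : Matrix m n → Fin m → Vector ℤ n → Matrix m n
M [ i ≔ v ] = updateAt M i (const v)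

minor-[≔] : ∀ j (M : Matrix (suc n) (suc n)) i v →
            minor j (M [ suc i ≔ v ]) ≋ minor j M [ i ≔ v ∘ punchIn j ]
minor-[≔] j M i v l k = cong (_$ k) (map-updateAt {f = _∘ punchIn j} (λ _ → refl) (tail M) i l)

[≔]-cong : ∀ (M : Matrix m n) i {u v} → u ≗ v → M [ i ≔ u ] ≋ M [ i ≔ v ]
[≔]-cong M zero    u≗v zero    = u≗v
[≔]-cong M zero    u≗v (suc l) = λ _ → refl
[≔]-cong M (suc i) u≗v zero    = λ _ → refl
[≔]-cong M (suc i) u≗v (suc l) = [≔]-cong (tail M) i u≗v l

-- For `zero` the minors do not see the replaced row. For `suc i` the entries of the first row stay
-- fixed and each minor is linear by induction.
det-linear : ∀ (M : Matrix n n) i x y u v →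
             det (M [ i ≔ (λ j → x * u j + y * v j) ]) ≡ x * det (M [ i ≔ u ]) + y * det (M [ i ≔ v ])
det-linear {suc n} M zero x y u v =
  trans (sum-cong-≗ λ j → distrib (-1ℤ ^ toℕ j) (u j) (v j) (det (minor j M)) x y)
        (sum-linear x y (λ j → (-1ℤ ^ toℕ j) * u j * det (minor j M))
                        (λ j → (-1ℤ ^ toℕ j) * v j * det (minor j M)))
  where
  distrib : ∀ s a b d x y → s * (x * a + y * b) * d ≡ x * (s * a * d) + y * (s * b * d)
  distrib = solve-∀
det-linear {suc n} M (suc i) x y u v =
  trans (sum-cong-≗ λ j → begin
          s j * M zero j * det (minor j (M [ suc i ≔ w ]))
            ≡⟨ cong (s j * M zero j *_) (minor-linear j) ⟩
          s j * M zero j * (x * D u j + y * D v j)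
            ≡⟨ distrib (s j * M zero j) x y (D u j) (D v j) ⟩
          x * (s j * M zero j * D u j) + y * (s j * M zero j * D v j) ∎)
        (sum-linear x y (λ j → s j * M zero j * D u j) (λ j → s j * M zero j * D v j))
  where
  open ≡-Reasoning
  s : Fin (suc n) → ℤ
  s j = -1ℤ ^ toℕ j
  w : Vector ℤ (suc n)
  w j = x * u j + y * v j
  D : Vector ℤ (suc n) → Fin (suc n) → ℤ
  D v j = det (minor j (M [ suc i ≔ v ]))
  distrib : ∀ a x y d e → a * (x * d + y * e) ≡ x * (a * d) + y * (a * e)
  distrib = solve-∀
  minor-linear : ∀ j → D w j ≡ x * D u j + y * D v j
  minor-linear j = begin
    D w j
      ≡⟨ det-cong (minor-[≔] j M i w) ⟩
    det (minor j M [ i ≔ w ∘ punchIn j ])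
      ≡⟨ det-linear (minor j M) i x y (u ∘ punchIn j) (v ∘ punchIn j) ⟩
    x * det (minor j M [ i ≔ u ∘ punchIn j ]) + y * det (minor j M [ i ≔ v ∘ punchIn j ])
      ≡⟨ cong₂ (λ d e → x * d + y * e) (det-cong (minor-[≔] j M i u)) (det-cong (minor-[≔] j M i v)) ⟨
    x * D u j + y * D v j ∎

-- Induction on `n`: split off the zeroth coordinate and pass to the functional `L ∘ (0ℤ ∷ᵛ_)`.
-- Vectors are functions, so `L-cong` stands in for extensionality.
linear⇒combination : (L : Vector ℤ n → ℤ) → (∀ {u v} → u ≗ v → L u ≡ L v) →
                     (∀ x y u v → L (λ j → x * u j + y * v j) ≡ x * L u + y * L v) →
                     ∀ v → L v ≡ ∑[ j < n ] (v j * L (basisVector j))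
linear⇒combination {zero} L L-cong L-linear v =
  -- All empty vectors agree, and linearity with both coefficients `0ℤ` makes `L` vanish on them.
  trans (L-cong λ ()) (L-linear 0ℤ 0ℤ v v)
linear⇒combination {suc n} L L-cong L-linear v = begin
  L v
    ≡⟨ L-cong split ⟩
  L (λ j → v zero * basisVector zero j + 1ℤ * (0ℤ ∷ᵛ tail v) j)
    ≡⟨ L-linear (v zero) 1ℤ (basisVector zero) (0ℤ ∷ᵛ tail v) ⟩
  v zero * L (basisVector zero) + 1ℤ * L (0ℤ ∷ᵛ tail v)
    ≡⟨ cong (v zero * L (basisVector zero) +_) (ℤ.*-identityˡ _) ⟩
  v zero * L (basisVector zero) + L (0ℤ ∷ᵛ tail v)
    ≡⟨ cong (v zero * L (basisVector zero) +_)
         (linear⇒combination (L ∘ (0ℤ ∷ᵛ_)) (L-cong ∘ 0∷-cong) L∷-linear (tail v)) ⟩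
  v zero * L (basisVector zero) + ∑[ j < n ] (v (suc j) * L (0ℤ ∷ᵛ basisVector j))
    ≡⟨ cong (v zero * L (basisVector zero) +_)
         (sum-cong-≗ λ j → cong (v (suc j) *_) (L-cong λ { zero → refl ; (suc _) → refl })) ⟩
  v zero * L (basisVector zero) + ∑[ j < n ] (v (suc j) * L (basisVector (suc j))) ∎
  where
  open ≡-Reasoning
  0∷-cong : ∀ {u v : Vector ℤ n} → u ≗ v → (0ℤ ∷ᵛ u) ≗ (0ℤ ∷ᵛ v)
  0∷-cong u≗v zero    = refl
  0∷-cong u≗v (suc j) = u≗v j
  one : ∀ x → x ≡ x * 1ℤ + 1ℤ * 0ℤ
  one = solve-∀
  rest : ∀ x y → y ≡ x * 0ℤ + 1ℤ * y
  rest = solve-∀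
  split : ∀ j → v j ≡ v zero * basisVector zero j + 1ℤ * (0ℤ ∷ᵛ tail v) j
  split zero    = one (v zero)
  split (suc j) = rest (v zero) (v (suc j))
  L∷-linear : ∀ x y u w → L (0ℤ ∷ᵛ λ j → x * u j + y * w j) ≡ x * L (0ℤ ∷ᵛ u) + y * L (0ℤ ∷ᵛ w)
  L∷-linear x y u w =
    trans (L-cong λ { zero → sym (cong₂ _+_ (ℤ.*-zeroʳ x) (ℤ.*-zeroʳ y)) ; (suc _) → refl })
          (L-linear x y (0ℤ ∷ᵛ u) (0ℤ ∷ᵛ w))

-- Laplace expansion along an arbitrary row: `det (M [ i ≔ basisVector j ])` is the cofactor at row
-- `i` and column `j`.
det-[≔]-expand : ∀ (M : Matrix n n) i v →
                 det (M [ i ≔ v ]) ≡ ∑[ j < n ] (v j * det (M [ i ≔ basisVector j ]))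
det-[≔]-expand M i =
  linear⇒combination (λ v → det (M [ i ≔ v ])) (det-cong ∘ [≔]-cong M i) (det-linear M i)

-- The pairs of distinct a < b in Fin (suc n) are a = inject₁ i, b = suc k with
-- i ≤ k; then b = punchIn a k and a = punchIn b i.
sum-antisymmetric : (F : Fin (suc n) → Fin n → ℤ) →
                    (∀ i k → i Fin.≤ k → F (inject₁ i) k + F (suc k) i ≡ 0ℤ) →
                    ∑[ j < suc n ] ∑[ k < n ] F j k ≡ 0ℤ
sum-antisymmetric {zero}  F anti = refl
sum-antisymmetric {suc n} F anti = begin
  sum (F zero) + ∑[ j < suc n ] (F (suc j) zero + ∑[ k < n ] F (suc j) (suc k))
    ≡⟨ cong (sum (F zero) +_) (∑-distrib-+ (λ j → F (suc j) zero) (λ j → ∑[ k < n ] F (suc j) (suc k))) ⟩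
  sum (F zero) + (∑[ j < suc n ] F (suc j) zero + ∑[ j < suc n ] ∑[ k < n ] F (suc j) (suc k))
    ≡⟨ cong (λ z → sum (F zero) + (∑[ j < suc n ] F (suc j) zero + z))
         (sum-antisymmetric (λ j k → F (suc j) (suc k)) λ i k i≤k → anti (suc i) (suc k) (s≤s i≤k)) ⟩
  sum (F zero) + (∑[ j < suc n ] F (suc j) zero + 0ℤ)
    ≡⟨ cong (sum (F zero) +_) (ℤ.+-identityʳ _) ⟩
  sum (F zero) + ∑[ j < suc n ] F (suc j) zero
    ≡⟨ ∑-distrib-+ (F zero) (λ j → F (suc j) zero) ⟨
  ∑[ j < suc n ] (F zero j + F (suc j) zero)
    ≡⟨ sum-zero _ (λ k → anti zero k z≤n) ⟩
  0ℤ ∎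
  where open ≡-Reasoning

punchIn-inject₁ : ∀ (i k : Fin n) → i Fin.≤ k → punchIn (inject₁ i) k ≡ suc k
punchIn-inject₁ zero    k       _         = refl
punchIn-inject₁ (suc i) (suc k) (s≤s i≤k) = cong suc (punchIn-inject₁ i k i≤k)

punchIn-suc : ∀ (i k : Fin n) → i Fin.≤ k → punchIn (suc k) i ≡ inject₁ i
punchIn-suc zero    k       _         = refl
punchIn-suc (suc i) (suc k) (s≤s i≤k) = cong suc (punchIn-suc i k i≤k)

-- Both sides enumerate the columns left after removing `inject₁ i` and `suc k`, in either order.
-- Hence the two corresponding double minors agree.
punchIn-punchIn : ∀ (i k : Fin (suc n)) l → i Fin.≤ k →
                  punchIn (inject₁ i) (punchIn k l) ≡ punchIn (suc k) (punchIn i l)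
punchIn-punchIn zero    k       l       _         = refl
punchIn-punchIn (suc i) (suc k) zero    _         = refl
punchIn-punchIn (suc i) (suc k) (suc l) (s≤s i≤k) = cong suc (punchIn-punchIn i k l i≤k)

swap₀₁ : Matrix (suc (suc m)) n → Matrix (suc (suc m)) n
swap₀₁ M zero          = M (suc zero)
swap₀₁ M (suc zero)    = M zero
swap₀₁ M (suc (suc i)) = M (suc (suc i))

-- Expanding along two rows gives a sum over ordered pairs of distinct columns. The two orders of a
-- pair share the remaining minor but carry opposite signs, so their contributions to the total
-- cancel.
det-swap₀₁ : ∀ (M : Matrix (suc (suc n)) (suc (suc n))) → det M + det (swap₀₁ M) ≡ 0ℤ
det-swap₀₁ {n} M = begin
  det M + det (swap₀₁ M)
    ≡⟨ ∑-distrib-+ (λ j → s j * M₀ j * ∑[ k < suc n ] (s k * M₁ (punchIn j k) * D j k))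
                   (λ j → s j * M₁ j * ∑[ k < suc n ] (s k * M₀ (punchIn j k) * D j k)) ⟨
  ∑[ j < suc (suc n) ] (s j * M₀ j * ∑[ k < suc n ] (s k * M₁ (punchIn j k) * D j k)
                        + s j * M₁ j * ∑[ k < suc n ] (s k * M₀ (punchIn j k) * D j k))
    ≡⟨ sum-cong-≗ {suc (suc n)} (λ j → begin
         s j * M₀ j * ∑[ k < suc n ] (s k * M₁ (punchIn j k) * D j k)
           + s j * M₁ j * ∑[ k < suc n ] (s k * M₀ (punchIn j k) * D j k)
           ≡⟨ sum-linear (s j * M₀ j) (s j * M₁ j) (λ k → s k * M₁ (punchIn j k) * D j k)
                (λ k → s k * M₀ (punchIn j k) * D j k) ⟨
         ∑[ k < suc n ] F j k ∎) ⟩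
  ∑[ j < suc (suc n) ] ∑[ k < suc n ] F j k
    ≡⟨ sum-antisymmetric F F-anti ⟩
  0ℤ ∎
  where
  open ≡-Reasoning
  s : Fin m → ℤ
  s j = -1ℤ ^ toℕ j
  M₀ M₁ : Vector ℤ (suc (suc n))
  M₀ = M zero
  M₁ = M (suc zero)
  D : Fin (suc (suc n)) → Fin (suc n) → ℤ
  D j k = det (minor k (minor j M))
  F : Fin (suc (suc n)) → Fin (suc n) → ℤ
  F j k = s j * M₀ j * (s k * M₁ (punchIn j k) * D j k) + s j * M₁ j * (s k * M₀ (punchIn j k) * D j k)
  -- Here `a` and `b` are the signs of `i` and `k`. The extra factor `-1ℤ` is the sign of `suc k`
  -- relative to that of `k`, while `inject₁ i` has the sign of `i`.
  cancel : ∀ a b x₀ x₁ y₀ y₁ d →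
           (a * x₀ * (b * y₁ * d) + a * x₁ * (b * y₀ * d))
           + (-1ℤ * b * y₀ * (a * x₁ * d) + -1ℤ * b * y₁ * (a * x₀ * d)) ≡ 0ℤ
  cancel = solve-∀
  F-anti : ∀ i k → i Fin.≤ k → F (inject₁ i) k + F (suc k) i ≡ 0ℤ
  F-anti i k i≤k
    rewrite punchIn-inject₁ i k i≤k
          | punchIn-suc i k i≤k
          | toℕ-inject₁ i
          | det-cong {M = minor k (minor (inject₁ i) M)} {N = minor i (minor (suc k) M)}
              (λ l r → cong (M (suc (suc l))) (punchIn-punchIn i k r i≤k))
    = cancel (s i) (s k) (M₀ (inject₁ i)) (M₁ (inject₁ i)) (M₀ (suc k)) (M₁ (suc k)) (D (suc k) i)

x+x≡0⇒x≡0 : ∀ x → x + x ≡ 0ℤ → x ≡ 0ℤ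
x+x≡0⇒x≡0 x x+x≡0 = ℤ.*-cancelˡ-≡ (ℤ.+ 2) x 0ℤ (trans (double x) x+x≡0)
  where
  double : ∀ x → ℤ.+ 2 * x ≡ x + x
  double = solve-∀

-- If the repeat is in row one, the swap fixes `M`, so twice its determinant is zero. Otherwise the
-- swap moves row zero into row one, and every minor along the new first row again has its top row
-- repeated, so it vanishes by induction.
det-row₀-repeated : ∀ (M : Matrix (suc n) (suc n)) i → M zero ≗ M (suc i) → det M ≡ 0ℤ
det-row₀-repeated {suc n} M zero M₀≗M₁ =
  x+x≡0⇒x≡0 (det M) (trans (cong (det M +_) (det-cong M≋swap)) (det-swap₀₁ M))
  where
  open ≡-Reasoning
  M≋swap : M ≋ swap₀₁ M
  M≋swap zero          = M₀≗M₁
  M≋swap (suc zero)    = sym ∘ M₀≗M₁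
  M≋swap (suc (suc i)) = λ _ → refl
det-row₀-repeated {suc n} M (suc i) M₀≗Mᵢ = begin
  det M                   ≡⟨ ℤ.+-identityʳ (det M) ⟨
  det M + 0ℤ              ≡⟨ cong (det M +_) swap≡0 ⟨
  det M + det (swap₀₁ M)  ≡⟨ det-swap₀₁ M ⟩
  0ℤ                      ∎
  where
  open ≡-Reasoning
  swap≡0 : det (swap₀₁ M) ≡ 0ℤ
  swap≡0 = sum-zero _ λ j →
    trans (cong (-1ℤ ^ toℕ j * M (suc zero) j *_)
                (det-row₀-repeated (minor j (swap₀₁ M)) i (M₀≗Mᵢ ∘ punchIn j)))
          (ℤ.*-zeroʳ (-1ℤ ^ toℕ j * M (suc zero) j))

det-alternating : ∀ (M : Matrix n n) {i j} → i ≢ j → M i ≗ M j → det M ≡ 0ℤ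
det-alternating M {zero}  {zero}  i≢j Mᵢ≗Mⱼ = contradiction refl i≢j
det-alternating M {zero}  {suc j} i≢j Mᵢ≗Mⱼ = det-row₀-repeated M j Mᵢ≗Mⱼ
det-alternating M {suc i} {zero}  i≢j Mᵢ≗Mⱼ = det-row₀-repeated M i (sym ∘ Mᵢ≗Mⱼ)
det-alternating M {suc i} {suc j} i≢j Mᵢ≗Mⱼ = sum-zero _ λ k →
  trans (cong (-1ℤ ^ toℕ k * M zero k *_)
              (det-alternating (minor k M) (i≢j ∘ cong suc) (Mᵢ≗Mⱼ ∘ punchIn k)))
        (ℤ.*-zeroʳ (-1ℤ ^ toℕ k * M zero k))

-- The adjugate, that is, the transposed matrix of cofactors.
adj : Matrix n n → Matrix n n
adj M j i = det (M [ i ≔ basisVector j ])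

-- The left side expands the determinant of `M` with row `k` overwritten by row `i`. This matrix is
-- `M` itself if `i` equals `k`, and has two equal rows otherwise.
⊗-adj : ∀ (M : Matrix n n) i k → (M ⊗ adj M) i k ≡ det M * basisVector i k
⊗-adj M i k = trans (sym (det-[≔]-expand M k (M i))) replaced
  where
  replaced : det (M [ k ≔ M i ]) ≡ det M * basisVector i k
  replaced with i ≟ k
  ... | yes refl = trans (det-cong λ l r → cong (_$ r) (updateAt-id-local i M refl l)) (sym (ℤ.*-identityʳ _))
  ... | no i≢k = trans (det-alternating (M [ k ≔ M i ]) i≢k rows≗) (sym (ℤ.*-zeroʳ (det M)))
    where
    rows≗ : (M [ k ≔ M i ]) i ≗ (M [ k ≔ M i ]) k
    rows≗ r = cong (_$ r) (trans (updateAt-minimal i k M i≢k) (sym (updateAt-updates k M)))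

∣x∣≡1⇒x*x≡1 : ∀ x → ∣ x ∣ ≡ 1 → x * x ≡ 1ℤ
∣x∣≡1⇒x*x≡1 (ℤ.+ 1)        refl = refl
∣x∣≡1⇒x*x≡1 (ℤ.-[1+ 0 ]) refl = refl

-- Matrices acting on vectors

infixr 7 _·_

_·_ : Matrix m n → Vector ℤ n → Vector ℤ m
_·_ {n = n} M x i = ∑[ j < n ] (M i j * x j)

·-congˡ : ∀ (M : Matrix m n) {x y} → x ≗ y → M · x ≗ M · y
·-congˡ M x≗y i = sum-cong-≗ λ j → cong (M i j *_) (x≗y j)

·-congʳ : ∀ {M N : Matrix m n} x → M ≋ N → M · x ≗ N · x
·-congʳ x M≋N i = sum-cong-≗ λ j → cong (_* x j) (M≋N i j)

·-linear : ∀ (M : Matrix m n) a b x y i →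
           (M · λ j → a * x j + b * y j) i ≡ a * (M · x) i + b * (M · y) i
·-linear M a b x y i =
  trans (sum-cong-≗ λ j → distrib (M i j) a b (x j) (y j))
        (sum-linear a b (λ j → M i j * x j) (λ j → M i j * y j))
  where
  distrib : ∀ m a b x y → m * (a * x + b * y) ≡ a * (m * x) + b * (m * y)
  distrib = solve-∀

⊗-· : ∀ (M : Matrix m k) (N : Matrix k n) x → (M ⊗ N) · x ≗ M · N · x
⊗-· {k = k} {n = n} M N x i = begin
  ∑[ j < n ] (∑[ l < k ] (M i l * N l j) * x j)
    ≡⟨ sum-cong-≗ (λ j → *-distribʳ-sum (x j) (λ l → M i l * N l j)) ⟩
  ∑[ j < n ] ∑[ l < k ] (M i l * N l j * x j)
    ≡⟨ ∑-comm (λ j l → M i l * N l j * x j) ⟩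
  ∑[ l < k ] ∑[ j < n ] (M i l * N l j * x j)
    ≡⟨ sum-cong-≗ (λ l → trans (sum-cong-≗ λ j → ℤ.*-assoc (M i l) (N l j) (x j))
                               (sym (*-distribˡ-sum (M i l) (λ j → N l j * x j)))) ⟩
  ∑[ l < k ] (M i l * ∑[ j < n ] (N l j * x j)) ∎
  where open ≡-Reasoning

·-basisVector : ∀ (M : Matrix m n) j i → (M · basisVector j) i ≡ M i j
·-basisVector M j i = sum-basisVector j (M i)

basisVector-· : ∀ (x : Vector ℤ n) → basisVector · x ≗ x
basisVector-· x i = trans (sum-cong-≗ λ j → ℤ.*-comm (basisVector i j) (x j)) (sum-basisVector i x)

unimodular⇒rightInverse : ∀ {M : Matrix n n} → Unimodular M → ∃ λ N → ∀ x → M · N · x ≗ x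
unimodular⇒rightInverse {n} {M} ∣M∣≡1 = N , λ x i → begin
  (M · N · x) i           ≡⟨ ⊗-· M N x i ⟨
  ((M ⊗ N) · x) i         ≡⟨ ·-congʳ x M⊗N≋I i ⟩
  (basisVector · x) i     ≡⟨ basisVector-· x i ⟩
  x i                     ∎
  where
  open ≡-Reasoning
  N : Matrix n n
  -- The determinant is a sign, hence its own inverse, so multiplying the adjugate by it amounts to
  -- dividing by it.
  N i j = det M * adj M i j
  comm : ∀ m d a → m * (d * a) ≡ d * (m * a)
  comm = solve-∀
  M⊗N≋I : M ⊗ N ≋ basisVector
  M⊗N≋I i k = begin
    ∑[ j < n ] (M i j * (det M * adj M j k))
      ≡⟨ sum-cong-≗ (λ j → comm (M i j) (det M) (adj M j k)) ⟩
    ∑[ j < n ] (det M * (M i j * adj M j k))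
      ≡⟨ *-distribˡ-sum (det M) (λ j → M i j * adj M j k) ⟨
    det M * (M ⊗ adj M) i k
      ≡⟨ cong (det M *_) (⊗-adj M i k) ⟩
    det M * (det M * basisVector i k)
      ≡⟨ ℤ.*-assoc (det M) (det M) _ ⟨
    det M * det M * basisVector i k
      ≡⟨ cong (_* basisVector i k) (∣x∣≡1⇒x*x≡1 (det M) ∣M∣≡1) ⟩
    1ℤ * basisVector i k
      ≡⟨ ℤ.*-identityˡ _ ⟩
    basisVector i k ∎

-- Integer kernel vectors and injectivity

*≢0 : ∀ {x y} → x ≢ 0ℤ → y ≢ 0ℤ → x * y ≢ 0ℤ
*≢0 {x} x≢0 y≢0 xy≡0 with ℤ.i*j≡0⇒i≡0∨j≡0 x xy≡0
... | inj₁ x≡0 = x≢0 x≡0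
... | inj₂ y≡0 = y≢0 y≡0

-- Fraction-free elimination of one row and one column at a time.
kernel : ∀ (M : Matrix m (suc m)) → ∃ λ x → (∃ λ j → x j ≢ 0ℤ) × (∀ i → (M · x) i ≡ 0ℤ)
kernel {zero}  M = const 1ℤ , (zero , λ ()) , λ ()
kernel {suc m} M with any? (λ p → ¬? (M zero p ℤ.≟ 0ℤ))
-- A zero row imposes no condition, so it is dropped together with one column, whose coordinate is
-- set to `0ℤ`.
... | no M₀≡0 with kernel (λ i j → M (suc i) (suc j))
...   | y , (j , yⱼ≢0) , My≡0 = 0ℤ ∷ᵛ y , (suc j , yⱼ≢0) , Mx≡0
  where
  Mx≡0 : ∀ i → (M · (0ℤ ∷ᵛ y)) i ≡ 0ℤ
  Mx≡0 zero    = sum-zero _ λ j →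
    cong (_* (0ℤ ∷ᵛ y) j) (decidable-stable (M zero j ℤ.≟ 0ℤ) λ M₀ⱼ≢0 → M₀≡0 (j , M₀ⱼ≢0))
  Mx≡0 (suc i) = cong₂ _+_ (ℤ.*-zeroʳ (M (suc i) zero)) (My≡0 i)
kernel {suc m} M | yes (p , M₀ₚ≢0)
  with kernel (λ i j → M zero p * M (suc i) (punchIn p j) - M zero (punchIn p j) * M (suc i) p)
... | y , (j , yⱼ≢0) , Ny≡0 = x , (punchIn p j , xⱼ≢0) , Mx≡0
  where
  open ≡-Reasoning
  r : Vector ℤ (suc m)
  r j = M zero (punchIn p j)
  ry : ℤ
  ry = ∑[ j < suc m ] (r j * y j)
  x : Vector ℤ (suc (suc m))
  -- Solving row zero for coordinate `p` would divide by the pivot `M zero p`; scaling the other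
  -- coordinates by the pivot avoids this.
  x = insertAt (λ j → M zero p * y j) p (- ry)
  x-punchIn : ∀ j → x (punchIn p j) ≡ M zero p * y j
  x-punchIn = insertAt-punchIn (λ j → M zero p * y j) p (- ry)
  xⱼ≢0 : x (punchIn p j) ≢ 0ℤ
  xⱼ≢0 xⱼ≡0 = *≢0 M₀ₚ≢0 yⱼ≢0 (trans (sym (x-punchIn j)) xⱼ≡0)
  expand : ∀ i → (M · x) i ≡ M i p * (- ry) + ∑[ j < suc m ] (M i (punchIn p j) * (M zero p * y j))
  expand i = trans (sum-remove {i = p} (λ j → M i j * x j))
    (cong₂ _+_ (cong (M i p *_) (insertAt-lookup _ p _))
               (sum-cong-≗ λ j → cong (M i (punchIn p j) *_) (x-punchIn j)))
  combine : ∀ i → (M · x) i ≡ ∑[ j < suc m ] ((M zero p * M i (punchIn p j) - r j * M i p) * y j)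
  combine i = begin
    (M · x) i
      ≡⟨ expand i ⟩
    M i p * (- ry) + ∑[ j < suc m ] (M i (punchIn p j) * (M zero p * y j))
      ≡⟨ rearr (M i p) ry _ ⟩
    - M i p * ry + 1ℤ * ∑[ j < suc m ] (M i (punchIn p j) * (M zero p * y j))
      ≡⟨ sum-linear (- M i p) 1ℤ (λ j → r j * y j) (λ j → M i (punchIn p j) * (M zero p * y j)) ⟨
    ∑[ j < suc m ] (- M i p * (r j * y j) + 1ℤ * (M i (punchIn p j) * (M zero p * y j)))
      ≡⟨ sum-cong-≗ (λ j → factor (M i p) (r j) (y j) (M i (punchIn p j)) (M zero p)) ⟩
    ∑[ j < suc m ] ((M zero p * M i (punchIn p j) - r j * M i p) * y j) ∎
    where
    rearr : ∀ a s t → a * (- s) + t ≡ - a * s + 1ℤ * t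
    rearr = solve-∀
    factor : ∀ a r y b q → - a * (r * y) + 1ℤ * (b * (q * y)) ≡ (q * b - r * a) * y
    factor = solve-∀
  Mx≡0 : ∀ i → (M · x) i ≡ 0ℤ
  Mx≡0 zero    = trans (combine zero) (sum-zero _ λ j → vanish (M zero p) (r j) (y j))
    where
    vanish : ∀ q r y → (q * r - r * q) * y ≡ 0ℤ
    vanish = solve-∀
  Mx≡0 (suc i) = trans (combine (suc i)) (Ny≡0 i)

-- A kernel vector of [ x | N ] expresses a nonzero multiple of x as N · z′; applying M gives z′ = 0.
rightInverse⇒injective₀ : ∀ {M N : Matrix n n} → (∀ x → M · N · x ≗ x) →
                          ∀ x → (∀ i → (M · x) i ≡ 0ℤ) → ∀ i → x i ≡ 0ℤ
rightInverse⇒injective₀ {n} {M} {N} MN≗id x Mx≡0 i with kernel (λ i → x i ∷ᵛ N i)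
... | z , (j , zⱼ≢0) , ker = x≡0
  where
  open ≡-Reasoning
  z₀ : ℤ
  z₀ = z zero
  z′ : Vector ℤ n
  z′ = tail z
  z′≡0 : ∀ i → z′ i ≡ 0ℤ
  z′≡0 i = begin
    z′ i                                        ≡⟨ MN≗id z′ i ⟨
    (M · N · z′) i                              ≡⟨ pad z₀ _ ⟩
    z₀ * 0ℤ + 1ℤ * (M · N · z′) i               ≡⟨ cong (λ y → z₀ * y + 1ℤ * (M · N · z′) i) (Mx≡0 i) ⟨
    z₀ * (M · x) i + 1ℤ * (M · N · z′) i        ≡⟨ ·-linear M z₀ 1ℤ x (N · z′) i ⟨
    (M · λ i → z₀ * x i + 1ℤ * (N · z′) i) i    ≡⟨ ·-congˡ M (λ i → trans (flip-* z₀ (x i) _) (ker i)) i ⟩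
    (M · const 0ℤ) i                            ≡⟨ sum-zero _ (λ j → ℤ.*-zeroʳ (M i j)) ⟩
    0ℤ                                          ∎
    where
    pad : ∀ z₀ y → y ≡ z₀ * 0ℤ + 1ℤ * y
    pad = solve-∀
    flip-* : ∀ z₀ x y → z₀ * x + 1ℤ * y ≡ x * z₀ + y
    flip-* = solve-∀
  z₀≢0 : z₀ ≢ 0ℤ
  z₀≢0 z₀≡0 = zⱼ≢0 (z≡0 j)
    where
    z≡0 : ∀ j → z j ≡ 0ℤ
    z≡0 zero    = z₀≡0
    z≡0 (suc j) = z′≡0 j
  xz₀≡0 : x i * z₀ ≡ 0ℤ
  xz₀≡0 = begin
    x i * z₀               ≡⟨ ℤ.+-identityʳ _ ⟨
    x i * z₀ + 0ℤ          ≡⟨ cong (x i * z₀ +_) (sum-zero _ λ j →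
                                trans (cong (N i j *_) (z′≡0 j)) (ℤ.*-zeroʳ (N i j))) ⟨
    x i * z₀ + (N · z′) i  ≡⟨ ker i ⟩
    0ℤ                     ∎
  x≡0 : x i ≡ 0ℤ
  x≡0 with ℤ.i*j≡0⇒i≡0∨j≡0 (x i) xz₀≡0
  ... | inj₁ xᵢ≡0 = xᵢ≡0
  ... | inj₂ z₀≡0 = contradiction z₀≡0 z₀≢0

rightInverse⇒injective : ∀ {M N : Matrix n n} → (∀ x → M · N · x ≗ x) →
                         ∀ {x y} → M · x ≗ M · y → x ≗ y
rightInverse⇒injective {M = M} {N} MN≗id {x} {y} Mx≗My i =
  ℤ.i-j≡0⇒i≡j (x i) (y i) (trans (minus (x i) (y i)) (rightInverse⇒injective₀ {M = M} {N} MN≗id _ M-kills i))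
  where
  minus : ∀ x y → x - y ≡ 1ℤ * x + -1ℤ * y
  minus = solve-∀
  M-kills : ∀ i → (M · λ j → 1ℤ * x j + -1ℤ * y j) i ≡ 0ℤ
  M-kills i = trans (·-linear M 1ℤ -1ℤ x y i)
    (trans (sym (minus ((M · x) i) ((M · y) i))) (ℤ.i≡j⇒i-j≡0 (Mx≗My i)))

-- Abelian groups

module IntegerMultiples (Γ : AbelianGroup a ℓ) where
  private module Γ = AbelianGroup Γ
  open AbelianGroup Γ using (Carrier; _≈_; _∙_; ε; _⁻¹)
  open AbelianGroupProperties Γ
  open Mult Γ.commutativeMonoid renaming (_×_ to _×ℕ_)
  open Sum Γ.commutativeMonoid using () renaming (sum to ∑; sum-cong-≋ to ∑-cong; ∑-distrib-+ to ∑-distrib-∙)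
  open SetoidReasoning Γ.setoid

  infixr 8 _•_

  _•_ : ℤ → Carrier → Carrier
  (ℤ.+ n)    • x = n ×ℕ x
  ℤ.-[1+ n ] • x = (suc n ×ℕ x) ⁻¹

  ⊖-• : ∀ m n x → (m ⊖ n) • x ≈ (m ×ℕ x) ∙ (n ×ℕ x) ⁻¹
  ⊖-• zero    zero    x = Γ.sym (Γ.inverseʳ ε)
  ⊖-• zero    (suc n) x = Γ.sym (Γ.identityˡ _)
  ⊖-• (suc m) zero    x = Γ.sym (Γ.trans (Γ.∙-congˡ ε⁻¹≈ε) (Γ.identityʳ _))
  ⊖-• (suc m) (suc n) x rewrite ℤ.[1+m]⊖[1+n]≡m⊖n m n = begin
    (m ⊖ n) • x                                    ≈⟨ ⊖-• m n x ⟩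
    mx ∙ nx ⁻¹                                     ≈⟨ Γ.∙-congˡ (Γ.identityˡ (nx ⁻¹)) ⟨
    mx ∙ (ε ∙ nx ⁻¹)                               ≈⟨ Γ.∙-congˡ (Γ.∙-congʳ (Γ.inverseʳ x)) ⟨
    mx ∙ ((x ∙ x ⁻¹) ∙ nx ⁻¹)                      ≈⟨ Γ.∙-congˡ (Γ.assoc x (x ⁻¹) (nx ⁻¹)) ⟩
    mx ∙ (x ∙ (x ⁻¹ ∙ nx ⁻¹))                      ≈⟨ Γ.assoc mx x _ ⟨
    (mx ∙ x) ∙ (x ⁻¹ ∙ nx ⁻¹)                      ≈⟨ Γ.∙-cong (Γ.comm mx x) (⁻¹-∙-comm x nx) ⟩
    (x ∙ mx) ∙ (x ∙ nx) ⁻¹                         ∎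
    where
    mx = m ×ℕ x
    nx = n ×ℕ x

  •-homo-+ : ∀ i j x → (i + j) • x ≈ i • x ∙ j • x
  •-homo-+ (ℤ.+ m)      (ℤ.+ n)      x = ×-homo-+ x m n
  •-homo-+ (ℤ.+ m)      (ℤ.-[1+ n ]) x = ⊖-• m (suc n) x
  •-homo-+ (ℤ.-[1+ m ]) (ℤ.+ n)      x = Γ.trans (⊖-• n (suc m) x) (Γ.comm _ _)
  •-homo-+ (ℤ.-[1+ m ]) (ℤ.-[1+ n ]) x = begin
    (suc (suc (m ℕ.+ n)) ×ℕ x) ⁻¹   ≡⟨ cong (λ k → (suc k ×ℕ x) ⁻¹) (ℕ.+-suc m n) ⟨
    ((suc m ℕ.+ suc n) ×ℕ x) ⁻¹     ≈⟨ Γ.⁻¹-cong (×-homo-+ x (suc m) (suc n)) ⟩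
    (suc m ×ℕ x ∙ suc n ×ℕ x) ⁻¹                ≈⟨ ⁻¹-∙-comm _ _ ⟨
    (suc m ×ℕ x) ⁻¹ ∙ (suc n ×ℕ x) ⁻¹           ∎

  -- The map out of the free abelian group `ℤ^ n` determined by the images `g` of the basis vectors.
  combination : Vector Carrier n → Vector ℤ n → Carrier
  combination g z = ∑ λ i → z i • g i

  combination-cong : ∀ (g : Vector Carrier n) {y z} → y ≗ z → combination g y ≈ combination g z
  combination-cong g y≗z = ∑-cong λ i → Γ.reflexive (cong (_• g i) (y≗z i))

  combination-homo : ∀ (g : Vector Carrier n) y z →
                     combination g (λ i → y i + z i) ≈ combination g y ∙ combination g z
  combination-homo g y z =
    Γ.trans (∑-cong λ i → •-homo-+ (y i) (z i) (g i)) (∑-distrib-∙ (λ i → y i • g i) (λ i → z i • g i))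

  combination-0 : ∀ (g : Vector Carrier n) → combination g (λ _ → 0ℤ) ≈ ε
  combination-0 {n = zero}  g = Γ.refl
  combination-0 {n = suc n} g = Γ.trans (Γ.identityˡ _) (combination-0 (tail g))

  combination-basisVector : ∀ (g : Vector Carrier n) j → combination g (basisVector j) ≈ g j
  combination-basisVector g zero    =
    Γ.trans (Γ.∙-cong (Γ.identityʳ _) (combination-0 (tail g))) (Γ.identityʳ _)
  combination-basisVector g (suc j) = Γ.trans (Γ.identityˡ _) (combination-basisVector (tail g) j)

module _ (Γ : AbelianGroup a ℓ) (Δ : AbelianGroup b ℓ′) where
  private
    module Γ = AbelianGroup Γ
    module Δ = AbelianGroup Δ
  open SetoidReasoning Δ.setoid
  open AbelianGroupProperties Δ

  -- Between groups, preserving the operation suffices: `f Γ.ε` is idempotent and so trivial, and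
  -- inverses are unique.
  homomorphism : ∀ {f : Γ.Carrier → Δ.Carrier} → (∀ {x y} → x Γ.≈ y → f x Δ.≈ f y) →
                 (∀ x y → f (x Γ.∙ y) Δ.≈ f x Δ.∙ f y) → IsHom Γ Δ f
  homomorphism {f} f-cong f-∙ = record
    { isMonoidHomomorphism = record
      { isMagmaHomomorphism = record
        { isRelHomomorphism = record { cong = f-cong }
        ; homo = f-∙
        }
      ; ε-homo = f-ε
      }
    ; ⁻¹-homo = λ x → inverseˡ-unique (f (x Γ.⁻¹)) (f x)
        (Δ.trans (Δ.sym (f-∙ (x Γ.⁻¹) x)) (Δ.trans (f-cong (Γ.inverseˡ x)) f-ε))
    }
    where
    f-ε : f Γ.ε Δ.≈ Δ.ε
    f-ε = begin
      f Γ.ε                                   ≈⟨ //-rightDividesʳ (f Γ.ε) (f Γ.ε) ⟨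
      (f Γ.ε Δ.∙ f Γ.ε) Δ.∙ f Γ.ε Δ.⁻¹        ≈⟨ Δ.∙-congʳ (f-∙ Γ.ε Γ.ε) ⟨
      f (Γ.ε Γ.∙ Γ.ε) Δ.∙ f Γ.ε Δ.⁻¹          ≈⟨ Δ.∙-congʳ (f-cong (Γ.identityˡ Γ.ε)) ⟩
      f Γ.ε Δ.∙ f Γ.ε Δ.⁻¹                    ≈⟨ Δ.inverseʳ (f Γ.ε) ⟩
      Δ.ε                                     ∎

  -- The kernel of `f` is a subgroup, so once it contains `P` it contains everything that `P`
  -- generates; `kills` is this induction on membership.
  quotient-homomorphism : ∀ {f : Γ.Carrier → Δ.Carrier} → IsHom Γ Δ f → {P : Pred Γ.Carrier p} →
                          (∀ {x} → P x → f x Δ.≈ Δ.ε) → IsHom (quotient Γ P) Δ f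
  quotient-homomorphism {f = f} f-hom {P} P⇒ε = record
    { isMonoidHomomorphism = record
      { isMagmaHomomorphism = record
        { isRelHomomorphism = record { cong = λ {x} {y} h →
            x∙y⁻¹≈ε⇒x≈y (f x) (f y)
              (Δ.trans (Δ.∙-congˡ (Δ.sym (⁻¹-homo y))) (Δ.trans (Δ.sym (homo x (y Γ.⁻¹))) (kills h))) }
        ; homo = homo
        }
      ; ε-homo = ε-homo
      }
    ; ⁻¹-homo = ⁻¹-homo
    }
    where
    open IsHom Γ Δ f-hom
    kills : ∀ {x} → ⟨ Γ ⟩ P x → f x Δ.≈ Δ.ε
    kills (gen Px)         = P⇒ε Px
    kills ε∈               = ε-homo
    kills (∙-closed h₁ h₂) = Δ.trans (homo _ _) (Δ.trans (Δ.∙-cong (kills h₁) (kills h₂)) (Δ.identityˡ Δ.ε))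
    kills (⁻¹-closed h)    = Δ.trans (⁻¹-homo _) (Δ.trans (Δ.⁻¹-cong (kills h)) ε⁻¹≈ε)
    kills (resp x≈y h)     = Δ.trans (⟦⟧-cong (Γ.sym x≈y)) (kills h)

module _ (Γ : AbelianGroup a ℓ) where
  private module Γ = AbelianGroup Γ
  open AbelianGroupProperties Γ

  ≈⇒quotient≈ : ∀ {P : Pred Γ.Carrier p} {x y} → x Γ.≈ y → AbelianGroup._≈_ (quotient Γ P) x y
  ≈⇒quotient≈ x≈y = resp (Γ.sym (x≈y⇒x∙y⁻¹≈ε x≈y)) ε∈

  quotient-map : ∀ {P : Pred Γ.Carrier p} → IsHom Γ (quotient Γ P) (λ x → x)
  quotient-map {P = P} = homomorphism Γ (quotient Γ P) ≈⇒quotient≈ λ _ _ → ≈⇒quotient≈ Γ.refl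

  ⟨⟩-quotient : ∀ {P : Pred Γ.Carrier p} {Q : Pred Γ.Carrier q} {x} → ⟨ Γ ⟩ P x → ⟨ quotient Γ Q ⟩ P x
  ⟨⟩-quotient (gen Px)         = gen Px
  ⟨⟩-quotient ε∈               = ε∈
  ⟨⟩-quotient (∙-closed h₁ h₂) = ∙-closed (⟨⟩-quotient h₁) (⟨⟩-quotient h₂)
  ⟨⟩-quotient (⁻¹-closed h)    = ⁻¹-closed (⟨⟩-quotient h)
  ⟨⟩-quotient (resp x≈y h)     = resp (≈⇒quotient≈ x≈y) (⟨⟩-quotient h)

  ∈⟨⟩⇒quotient≈ε : ∀ {P : Pred Γ.Carrier p} x → ⟨ Γ ⟩ P x →
                   AbelianGroup._≈_ (quotient Γ P) x Γ.ε
  ∈⟨⟩⇒quotient≈ε x h = resp (Γ.sym (Γ.trans (Γ.∙-congˡ ε⁻¹≈ε) (Γ.identityʳ _))) h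

-- Membership in generated subgroups

module _ (Γ : AbelianGroup a ℓ) {f : ℤ → AbelianGroup.Carrier Γ} (f-hom : IsHom ℤ.+-0-abelianGroup Γ f) where
  private module Γ = AbelianGroup Γ
  open IsHom ℤ.+-0-abelianGroup Γ f-hom

  -- A homomorphism out of ℤ is determined by its value at `1ℤ`. Leaving it general covers both
  -- integer multiples of a vector and multiples of `d` in ℤ.
  multiple∈ : ∀ {P : Pred Γ.Carrier p} → ⟨ Γ ⟩ P (f 1ℤ) → ∀ z → ⟨ Γ ⟩ P (f z)
  multiple∈ {P = P} f1∈ = go
    where
    go₊ : ∀ k → ⟨ Γ ⟩ P (f (ℤ.+ k))
    go₊ zero    = resp (Γ.sym ε-homo) ε∈
    go₊ (suc k) = resp (Γ.sym (homo 1ℤ (ℤ.+ k))) (∙-closed f1∈ (go₊ k))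
    go : ∀ z → ⟨ Γ ⟩ P (f z)
    go (ℤ.+ k)    = go₊ k
    go ℤ.-[1+ k ] = resp (Γ.sym (⁻¹-homo (ℤ.+ suc k))) (⁻¹-closed (go₊ (suc k)))

combination∈ : ∀ {P : Pred (Vector ℤ n) p} (v : Vector (Vector ℤ n) m) → (∀ i → ⟨ ℤ^ n ⟩ P (v i)) →
               ∀ (z : Vector ℤ m) → ⟨ ℤ^ n ⟩ P (λ j → ∑[ i < m ] (z i * v i j))
combination∈ {m = zero}          v v∈ z = resp (λ _ → refl) ε∈
combination∈ {n = n} {m = suc m} v v∈ z =
  ∙-closed (multiple∈ (ℤ^ n) scaling (resp (λ j → sym (ℤ.*-identityˡ (v zero j))) (v∈ zero)) (z zero))
           (combination∈ (tail v) (v∈ ∘ suc) (tail z))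
  where
  scaling : IsHom ℤ.+-0-abelianGroup (ℤ^ n) (λ x j → x * v zero j)
  scaling = homomorphism ℤ.+-0-abelianGroup (ℤ^ n)
    (λ x≡y j → cong (_* v zero j) x≡y) (λ x y j → ℤ.*-distribʳ-+ (v zero j) x y)

∈⟨+d⟩⇒multiple : ∀ {d x} → ⟨ ℤ.+-0-abelianGroup ⟩ (_≡ ℤ.+ d) x → ∃ λ q → x ≡ q * ℤ.+ d
∈⟨+d⟩⇒multiple {d} (gen refl) = 1ℤ , sym (ℤ.*-identityˡ (ℤ.+ d))
∈⟨+d⟩⇒multiple {d} ε∈ = 0ℤ , sym (ℤ.*-zeroˡ (ℤ.+ d))
∈⟨+d⟩⇒multiple {d} (∙-closed h₁ h₂) with ∈⟨+d⟩⇒multiple h₁ | ∈⟨+d⟩⇒multiple h₂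
... | q₁ , refl | q₂ , refl = q₁ + q₂ , sym (ℤ.*-distribʳ-+ (ℤ.+ d) q₁ q₂)
∈⟨+d⟩⇒multiple {d} (⁻¹-closed h) with ∈⟨+d⟩⇒multiple h
... | q , refl = - q , ℤ.neg-distribˡ-* q (ℤ.+ d)
∈⟨+d⟩⇒multiple (resp refl h) = ∈⟨+d⟩⇒multiple h

multiple⇒∈⟨+d⟩ : ∀ d q → ⟨ ℤ.+-0-abelianGroup ⟩ (_≡ ℤ.+ d) (q * ℤ.+ d)
multiple⇒∈⟨+d⟩ d = multiple∈ ℤ.+-0-abelianGroup scaling (gen (ℤ.*-identityˡ (ℤ.+ d)))
  where
  scaling : IsHom ℤ.+-0-abelianGroup ℤ.+-0-abelianGroup (_* ℤ.+ d)
  scaling = homomorphism ℤ.+-0-abelianGroup ℤ.+-0-abelianGroup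
    (cong (_* ℤ.+ d)) (ℤ.*-distribʳ-+ (ℤ.+ d))

-- Signed sums along walks

module _ {G : Graph} (𝒫 : OrientedPartition G t) where
  open Graph G
  open OrientedPartition 𝒫

  -- The crossing vector is the signed sum of the basis vectors in `ℤ^ t`, and homomorphisms carry
  -- signed sums to signed sums. It is applied to the quotient map for consistency and to
  -- `combination` for universality.
  crossings-homomorphism : ∀ (Γ : AbelianGroup a ℓ) {f} → IsHom (ℤ^ t) Γ f →
    ∀ {g} → (∀ j → AbelianGroup._≈_ Γ (f (basisVector j)) (g j)) →
    ∀ {u v} (w : Walk u v) → AbelianGroup._≈_ Γ (f (crossings w)) (signedSum Γ g w)
  crossings-homomorphism Γ {f} f-hom {g} f-basis = go
    where
    module Γ = AbelianGroup Γ
    open IsHom (ℤ^ t) Γ f-hom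
    signed : ∀ s i → f (λ j → (if s then 1ℤ else -1ℤ) * basisVector i j) Γ.≈ (if s then g i else g i Γ.⁻¹)
    signed true  i = Γ.trans (⟦⟧-cong λ j → ℤ.*-identityˡ (basisVector i j)) (f-basis i)
    signed false i = Γ.trans (⟦⟧-cong λ j → ℤ.-1*i≡-i (basisVector i j))
                             (Γ.trans (⁻¹-homo (basisVector i)) (Γ.⁻¹-cong (f-basis i)))
    go : ∀ {u v} (w : Walk u v) → f (crossings w) Γ.≈ signedSum Γ g w
    go nil     = ε-homo
    go (e ◅ w) = Γ.trans (homo _ (crossings w)) (Γ.∙-cong (signed (forward e) (class e)) (go w))

  signedSum-◅◅ : ∀ (Γ : AbelianGroup a ℓ) g {u v x} (w : Walk u v) (w′ : Walk v x) →
    AbelianGroup._≈_ Γ (signedSum Γ g (w ◅◅ w′))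
                       (AbelianGroup._∙_ Γ (signedSum Γ g w) (signedSum Γ g w′))
  signedSum-◅◅ Γ g nil     w′ = AbelianGroup.sym Γ (AbelianGroup.identityˡ Γ _)
  signedSum-◅◅ Γ g (e ◅ w) w′ =
    AbelianGroup.trans Γ (AbelianGroup.∙-congˡ Γ (signedSum-◅◅ Γ g w w′))
                         (AbelianGroup.sym Γ (AbelianGroup.assoc Γ _ _ _))

  -- Extending by `0ℤ` to pairs that are not edges makes it the coefficient array of a linear form
  -- on all of `V × V`.
  forwardIndicator : Fin t → V → V → ℤ
  forwardIndicator j x y with ~-dec x y
  ... | yes e = if forward e then basisVector (class e) j else 0ℤ
  ... | no  _ = 0ℤ

  forwardIndicator-edge : ∀ j {x y} (e : x ~ y) →
    forwardIndicator j x y ≡ (if forward e then basisVector (class e) j else 0ℤ)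
  forwardIndicator-edge j {x} {y} e with ~-dec x y
  -- `class` and `forward` depend on the edge itself, so the edge found by `~-dec` must be
  -- identified with `e`.
  ... | yes e′ rewrite ~-irrelevant e′ e = refl
  ... | no ¬e = contradiction e ¬e

  -- Exactly one orientation of the edge is forward, so one of the two terms vanishes and the
  -- surviving one carries the sign of the traversal.
  crossing-edge : ∀ j {x y} (e : x ~ y) →
    forwardIndicator j x y - forwardIndicator j y x
    ≡ (if forward e then 1ℤ else -1ℤ) * basisVector (class e) j
  crossing-edge j e
    rewrite forwardIndicator-edge j e | forwardIndicator-edge j (~-sym e) | class-sym e | forward-sym e
    with forward e
  ... | true  = trans (ℤ.+-identityʳ _) (sym (ℤ.*-identityˡ _))
  ... | false = trans (ℤ.+-identityˡ _) (sym (ℤ.-1*i≡-i _))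

  -- A flow records each edge at two ordered pairs with opposite values. Only the forward pair can
  -- have a nonzero coefficient, so each edge counts once.
  crossingForm : Fin t → (V × V → ℤ) → ℤ
  crossingForm j h = ∑[ x < order ] ∑[ y < order ] (forwardIndicator j x y * h (x , y))

  indicator-× : ∀ {P : Set p} {Q : Set q} (P? : Dec P) (Q? : Dec Q) →
                indicator (P? ×-dec Q?) ≡ indicator P? * indicator Q?
  indicator-× (yes _) (yes _) = refl
  indicator-× (yes _) (no  _) = refl
  indicator-× (no  _) (yes _) = refl
  indicator-× (no  _) (no  _) = refl

  sum-indicator : ∀ {m n} (f : Fin m → Fin n → ℤ) u v →
    ∑[ x < m ] ∑[ y < n ] (f x y * indicator ((u ≟ x) ×-dec (v ≟ y))) ≡ f u v
  sum-indicator {m} {n} f u v = trans (sum-cong-≗ λ x → begin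
      ∑[ y < n ] (f x y * indicator ((u ≟ x) ×-dec (v ≟ y)))
        ≡⟨ sum-cong-≗ (λ y → trans (cong (f x y *_) (indicator-× (u ≟ x) (v ≟ y)))
                                   (rotate (f x y) (basisVector u x) (basisVector v y))) ⟩
      ∑[ y < n ] (f x y * basisVector v y * basisVector u x)
        ≡⟨ *-distribʳ-sum (basisVector u x) (λ y → f x y * basisVector v y) ⟨
      ∑[ y < n ] (f x y * basisVector v y) * basisVector u x
        ≡⟨ cong (_* basisVector u x) (sum-basisVector v (f x)) ⟩
      f x v * basisVector u x ∎)
    (sum-basisVector u (λ x → f x v))
    where
    open ≡-Reasoning
    rotate : ∀ a b c → a * (b * c) ≡ a * c * b
    rotate = solve-∀

  crossingForm-combination : ∀ j {n} (z : Vector ℤ n) (h : Vector (V × V → ℤ) n) →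
    crossingForm j (λ e → ∑[ i < n ] (z i * h i e)) ≡ ∑[ i < n ] (z i * crossingForm j (h i))
  crossingForm-combination j {n} z h = begin
    ∑[ x < order ] ∑[ y < order ] (κ x y * ∑[ i < n ] (z i * h i (x , y)))
      ≡⟨ sum-cong-≗ (λ x → sum-cong-≗ λ y → trans (*-distribˡ-sum (κ x y) (λ i → z i * h i (x , y)))
           (sum-cong-≗ λ i → swap (κ x y) (z i) (h i (x , y)))) ⟩
    ∑[ x < order ] ∑[ y < order ] ∑[ i < n ] (z i * (κ x y * h i (x , y)))
      ≡⟨ sum-cong-≗ (λ x → ∑-comm (λ y i → z i * (κ x y * h i (x , y)))) ⟩
    ∑[ x < order ] ∑[ i < n ] ∑[ y < order ] (z i * (κ x y * h i (x , y)))
      ≡⟨ ∑-comm (λ x i → ∑[ y < order ] (z i * (κ x y * h i (x , y)))) ⟩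
    ∑[ i < n ] ∑[ x < order ] ∑[ y < order ] (z i * (κ x y * h i (x , y)))
      ≡⟨ sum-cong-≗ (λ i → trans (*-distribˡ-sum (z i) (λ x → ∑[ y < order ] (κ x y * h i (x , y))))
           (sum-cong-≗ λ x → *-distribˡ-sum (z i) (λ y → κ x y * h i (x , y)))) ⟨
    ∑[ i < n ] (z i * crossingForm j (h i)) ∎
    where
    open ≡-Reasoning
    κ : V → V → ℤ
    κ = forwardIndicator j
    swap : ∀ a b c → a * (b * c) ≡ b * (a * c)
    swap = solve-∀

  -- Both sides are additive over the edges of the walk. A cycle basis is specified through flows,
  -- and this transfers its relations to crossing numbers.
  crossings-flow : ∀ j {u v} (w : Walk u v) → crossings w j ≡ crossingForm j (flow w)
  crossings-flow j nil = sym (sum-zero _ λ x → sum-zero _ λ y → ℤ.*-zeroʳ (forwardIndicator j x y))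
  crossings-flow j (_◅_ {u} {v} e w) = begin
    (if forward e then 1ℤ else -1ℤ) * basisVector (class e) j + crossings w j
      ≡⟨ cong₂ _+_ (sym (crossing-edge j e)) (crossings-flow j w) ⟩
    κ u v - κ v u + crossingForm j (flow w)
      ≡⟨ cong₂ (λ s t → s - t + crossingForm j (flow w)) (sum-indicator κ u v)
           (trans (∑-comm (λ x y → κ x y * δ⁻ (x , y))) (sum-indicator (λ y x → κ x y) u v)) ⟨
    crossingForm j δ⁺ - crossingForm j δ⁻ + crossingForm j (flow w)
      ≡⟨ expand (crossingForm j δ⁺) (crossingForm j δ⁻) (crossingForm j (flow w)) ⟩
    ∑[ i < 3 ] (z i * crossingForm j (h i))
      ≡⟨ crossingForm-combination j z h ⟨
    crossingForm j (λ e → ∑[ i < 3 ] (z i * h i e))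
      ≡⟨ sum-cong-≗ (λ x → sum-cong-≗ λ y → cong (κ x y *_)
           (expand (δ⁺ (x , y)) (δ⁻ (x , y)) (flow w (x , y)))) ⟨
    crossingForm j (flow (e ◅ w)) ∎
    where
    open ≡-Reasoning
    κ : V → V → ℤ
    κ = forwardIndicator j
    δ⁺ δ⁻ : V × V → ℤ
    δ⁺ (x , y) = indicator ((u ≟ x) ×-dec (v ≟ y))
    δ⁻ (x , y) = indicator ((u ≟ y) ×-dec (v ≟ x))
    z : Vector ℤ 3
    -- The flow of `e ◅ w` is written as a combination of three arrays, so that linearity of the
    -- form applies.
    z = 1ℤ ∷ᵛ -1ℤ ∷ᵛ 1ℤ ∷ᵛ []ᵛ
    h : Vector (V × V → ℤ) 3
    h = δ⁺ ∷ᵛ δ⁻ ∷ᵛ flow w ∷ᵛ []ᵛ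
    expand : ∀ a b c → a - b + c ≡ 1ℤ * a + (-1ℤ * b + (1ℤ * c + 0ℤ))
    expand = solve-∀

  cycle-crossings : ∀ {c} {B : Vector Cycle c} → IsCycleBasis B → ∀ (C : Cycle) →
    ∃ λ z → ∀ j → crossings (Cycle.walk C) j ≡ ∑[ i < c ] (z i * cycleClassMatrix B i j)
  cycle-crossings {c} {B} basis C = z , λ j → begin
    crossings (Cycle.walk C) j
      ≡⟨ crossings-flow j (Cycle.walk C) ⟩
    crossingForm j (flow (Cycle.walk C))
      ≡⟨ sum-cong-≗ (λ x → sum-cong-≗ λ y → cong (forwardIndicator j x y *_) (flow≡ (x , y))) ⟩
    crossingForm j (λ e → ∑[ i < c ] (z i * flow (Cycle.walk (B i)) e))
      ≡⟨ crossingForm-combination j z (λ i → flow (Cycle.walk (B i))) ⟩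
    ∑[ i < c ] (z i * crossingForm j (flow (Cycle.walk (B i))))
      ≡⟨ sum-cong-≗ (λ i → cong (z i *_) (crossings-flow j (Cycle.walk (B i)))) ⟨
    ∑[ i < c ] (z i * cycleClassMatrix B i j) ∎
    where
    open ≡-Reasoning
    z = proj₁ (IsCycleBasis.spanning basis C)
    flow≡ = proj₂ (IsCycleBasis.spanning basis C)

  basisVector-consistent : ∀ {c} {B : Vector Cycle c} → IsCycleBasis B →
                           Consistent (ℤ^t/rowlattice (cycleClassMatrix B)) basisVector
  basisVector-consistent {c} {B} basis C with cycle-crossings basis C
  ... | z , crossings≡ = begin
    signedSum Γuniv basisVector (Cycle.walk C)
      ≈⟨ crossings-homomorphism Γuniv (quotient-map (ℤ^ t))
           (λ j → AbelianGroup.refl Γuniv {basisVector j}) (Cycle.walk C) ⟨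
    crossings (Cycle.walk C)
      ≈⟨ ≈⇒quotient≈ (ℤ^ t) crossings≡ ⟩
    (λ j → ∑[ i < c ] (z i * A i j))
      ≈⟨ ∈⟨⟩⇒quotient≈ε (ℤ^ t) (λ j → ∑[ i < c ] (z i * A i j))
           (combination∈ A (λ i → gen (i , λ _ → refl)) z) ⟩
    ε ∎
    where
    A = cycleClassMatrix B
    Γuniv = ℤ^t/rowlattice A
    open AbelianGroup Γuniv using (ε; setoid)
    open SetoidReasoning setoid

  -- A row of the matrix is the crossing vector of a basis cycle. `combination g′` sends it to the
  -- signed sum around that cycle, which consistency makes trivial, so the map descends to the
  -- quotient.
  universal : ∀ {c} (B : Vector Cycle c) (Γ : AbelianGroup a ℓ) {g′ : Vector (AbelianGroup.Carrier Γ) t} →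
              Consistent Γ g′ → IsHomomorphicImage (ℤ^t/rowlattice (cycleClassMatrix B)) Γ basisVector g′
  universal B Γ {g′} consistent = f , quotient-homomorphism (ℤ^ t) Γ f-hom f-rows , combination-basisVector g′
    where
    module Γ = AbelianGroup Γ
    open IntegerMultiples Γ
    f : Vector ℤ t → Γ.Carrier
    f = combination g′
    f-hom : IsHom (ℤ^ t) Γ f
    f-hom = homomorphism (ℤ^ t) Γ (combination-cong g′) (combination-homo g′)
    f-rows : ∀ {x} → (∃ λ i → ∀ j → x j ≡ cycleClassMatrix B i j) → f x Γ.≈ Γ.ε
    f-rows {x} (i , x≗Aᵢ) = Γ.trans (combination-cong g′ x≗Aᵢ)
      (Γ.trans (crossings-homomorphism Γ f-hom (combination-basisVector g′) (Cycle.walk (B i)))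
               (consistent (B i)))

basisVector-generates : ∀ {m t} (A : Matrix m t) → Generates (ℤ^t/rowlattice A) basisVector
basisVector-generates {t = t} A x = ⟨⟩-quotient (ℤ^ t)
  (resp (λ j → trans (sum-cong-≗ λ i → cong (x i *_) (basisVector-sym i j)) (sum-basisVector j x))
        (combination∈ basisVector (λ i → gen (i , AbelianGroup.refl (ℤ^t/rowlattice A) {basisVector i})) x))

-- Smith normal form

diag-torsion : ∀ (d : Vector ℕ ρ) (ρ≤m : ρ ≤ m) (ρ≤n : ρ ≤ n) z i →
               (diag {m = m} d · z) (torsionIndex ρ≤m i) ≡ z (torsionIndex ρ≤n i) * ℤ.+ d i
diag-torsion d (s≤s ρ≤m) (s≤s ρ≤n) z zero =
  trans (cong₂ _+_ (ℤ.*-comm (ℤ.+ d zero) (z zero)) (sum-zero _ λ j → ℤ.*-zeroˡ (z (suc j))))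
        (ℤ.+-identityʳ _)
diag-torsion d (s≤s ρ≤m) (s≤s ρ≤n) z (suc i) =
  trans (cong₂ _+_ (ℤ.*-zeroˡ (z zero)) (diag-torsion (tail d) ρ≤m ρ≤n (tail z) i)) (ℤ.+-identityˡ _)

diag-free : ∀ (d : Vector ℕ ρ) (ρ≤m : ρ ≤ m) (ρ≤n : ρ ≤ n) z i →
            (diag {m = m} {n = n} d · z) (freeIndex ρ≤m i) ≡ 0ℤ
diag-free d z≤n       ρ≤n       z i = sum-zero _ λ j → ℤ.*-zeroˡ (z j)
diag-free d (s≤s ρ≤m) (s≤s ρ≤n) z i =
  trans (cong₂ _+_ (ℤ.*-zeroˡ (z zero)) (diag-free (tail d) ρ≤m ρ≤n (tail z) i)) (ℤ.+-identityˡ _)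

torsion-free-elim : (ρ≤t : ρ ≤ t) (Q : Pred (Fin t) p) →
                    (∀ i → Q (torsionIndex ρ≤t i)) → (∀ i → Q (freeIndex ρ≤t i)) → ∀ k → Q k
-- With no torsion positions, `freeIndex` is a `cast` of `k` to its own type, which `cast-is-id`
-- removes.
torsion-free-elim z≤n       Q Q-torsion Q-free k       = subst Q (cast-is-id refl k) (Q-free k)
torsion-free-elim (s≤s ρ≤t) Q Q-torsion Q-free zero    = Q-torsion zero
torsion-free-elim (s≤s ρ≤t) Q Q-torsion Q-free (suc k) =
  torsion-free-elim ρ≤t (Q ∘ suc) (Q-torsion ∘ suc) Q-free k

assemble : ∀ {A : Set a} (ρ≤t : ρ ≤ t) (x : Vector A ρ) (y : Vector A (t ∸ ρ)) →
           ∃ λ (v : Vector A t) → (∀ i → v (torsionIndex ρ≤t i) ≡ x i) × (∀ i → v (freeIndex ρ≤t i) ≡ y i)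
assemble z≤n       x y = y , (λ ()) , λ i → cong y (cast-is-id refl i)
assemble (s≤s ρ≤t) x y with assemble ρ≤t (tail x) y
... | v , v-torsion , v-free = x zero ∷ᵛ v , (λ { zero → refl ; (suc i) → v-torsion i }) , v-free

module SmithNormalForm {t c ρ} {A : Matrix c t} (ρ≤t : ρ ≤ t) (ρ≤c : ρ ≤ c)
         {U : Matrix t t} {W : Matrix c c} (d : Vector ℕ ρ)
         (U-unimodular : Unimodular U) (W-unimodular : Unimodular W)
         (UAᵀW≋diag : U ⊗ A ᵀ ⊗ W ≋ diag d) where

  private
    Γuniv = ℤ^t/rowlattice A
    Δ = Π (λ i → ℤ/ (d i)) ×ᴳ ℤ^ (t ∸ ρ)
    module Γuniv = AbelianGroup Γuniv
    module Δ = AbelianGroup Δ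

    U⁻¹ = proj₁ (unimodular⇒rightInverse {M = U} U-unimodular)
    U·U⁻¹· = proj₂ (unimodular⇒rightInverse {M = U} U-unimodular)
    W⁻¹ = proj₁ (unimodular⇒rightInverse {M = W} W-unimodular)
    W·W⁻¹· = proj₂ (unimodular⇒rightInverse {M = W} W-unimodular)

    UAᵀW· : ∀ z → U · A ᵀ · W · z ≗ diag d · z
    UAᵀW· z k = begin
      (U · A ᵀ · W · z) k          ≡⟨ ⊗-· U (A ᵀ) (W · z) k ⟨
      ((U ⊗ A ᵀ) · W · z) k        ≡⟨ ⊗-· (U ⊗ A ᵀ) W z k ⟨
      ((U ⊗ A ᵀ ⊗ W) · z) k        ≡⟨ ·-congʳ z UAᵀW≋diag k ⟩
      (diag d · z) k               ∎
      where open ≡-Reasoning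

    -- Inserting `W · W⁻¹` before `y` brings in the Smith form. Thus `U` maps the row lattice into
    -- the image of `diag d`.
    UAᵀ· : ∀ y → U · A ᵀ · y ≗ diag d · W⁻¹ · y
    UAᵀ· y k = trans (·-congˡ U (·-congˡ (A ᵀ) (sym ∘ W·W⁻¹· y)) k) (UAᵀW· (W⁻¹ · y) k)

    row : ∀ i → A ᵀ · basisVector i ≗ A i
    row i = ·-basisVector (A ᵀ) i

  smith : Vector ℤ t → Δ.Carrier
  smith x = (λ i → (U · x) (torsionIndex ρ≤t i)) , (λ i → (U · x) (freeIndex ρ≤t i))

  private
    smith-cong : ∀ {x y} → x ≗ y → smith x Δ.≈ smith y
    smith-cong x≗y =
      (λ i → ≈⇒quotient≈ ℤ.+-0-abelianGroup (·-congˡ U x≗y (torsionIndex ρ≤t i))) ,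
      (λ i → ·-congˡ U x≗y (freeIndex ρ≤t i))

    ·-+ : ∀ x y → U · (λ j → x j + y j) ≗ λ k → (U · x) k + (U · y) k
    ·-+ x y k = trans (·-congˡ U (λ j → sym (one (x j) (y j))) k)
      (trans (·-linear U 1ℤ 1ℤ x y k) (one ((U · x) k) ((U · y) k)))
      where
      one : ∀ a b → 1ℤ * a + 1ℤ * b ≡ a + b
      one = solve-∀

    ·-‿- : ∀ x y → U · (λ j → x j - y j) ≗ λ k → (U · x) k - (U · y) k
    ·-‿- x y k = trans (·-congˡ U (λ j → sym (one (x j) (y j))) k)
      (trans (·-linear U 1ℤ -1ℤ x y k) (one ((U · x) k) ((U · y) k)))
      where
      one : ∀ a b → 1ℤ * a + -1ℤ * b ≡ a - b
      one = solve-∀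

    smith-hom : IsHom (ℤ^ t) Δ smith
    smith-hom = homomorphism (ℤ^ t) Δ smith-cong λ x y →
      (λ i → ≈⇒quotient≈ ℤ.+-0-abelianGroup (·-+ x y (torsionIndex ρ≤t i))) ,
      (λ i → ·-+ x y (freeIndex ρ≤t i))

    smith-row : ∀ {x} → (∃ λ i → ∀ j → x j ≡ A i j) → smith x Δ.≈ Δ.ε
    smith-row {x} (i , x≗Aᵢ) =
      (λ k → ∈⟨⟩⇒quotient≈ε ℤ.+-0-abelianGroup _
        (resp (sym (trans (Ux≗ (torsionIndex ρ≤t k)) (diag-torsion d ρ≤t ρ≤c z k)))
              (multiple⇒∈⟨+d⟩ (d k) (z (torsionIndex ρ≤c k))))) ,
      (λ k → trans (Ux≗ (freeIndex ρ≤t k)) (diag-free d ρ≤t ρ≤c z k))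
      where
      z : Vector ℤ c
      -- Row `i` of `A` is `A ᵀ` applied to the `i`-th basis vector, so `z` is the vector that
      -- `diag d` is applied to after the change of basis by `W`.
      z = W⁻¹ · basisVector i
      Ux≗ : U · x ≗ diag d · z
      Ux≗ k = trans (·-congˡ U (λ j → trans (x≗Aᵢ j) (sym (row i j))) k) (UAᵀ· (basisVector i) k)

    smith-Γuniv-hom : IsHom Γuniv Δ smith
    smith-Γuniv-hom = quotient-homomorphism (ℤ^ t) Δ smith-hom smith-row

    -- The quotients by the `d i` form a vector `z` such that `U` sends the difference of `x` and
    -- `y` to `diag d · z`, which is `U · A ᵀ · W · z`. Cancelling `U` exhibits the difference as
    -- the combination of rows with coefficients `W · z`.
    smith-injective : ∀ {x y} → smith x Δ.≈ smith y → x Γuniv.≈ y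
    smith-injective {x} {y} (torsion≈ , free≈) =
      resp (sym ∘ v≗) (combination∈ A (λ i → gen (i , λ _ → refl)) (W · z))
      where
      v : Vector ℤ t
      v j = x j - y j
      quotients : ∀ i → ∃ λ q → (U · x) (torsionIndex ρ≤t i) - (U · y) (torsionIndex ρ≤t i) ≡ q * ℤ.+ d i
      quotients i = ∈⟨+d⟩⇒multiple (torsion≈ i)
      -- Coordinates past `ρ` meet only zero columns of `diag d`, so the padding value `0ℤ` is
      -- arbitrary.
      assembled = assemble ρ≤c (λ i → proj₁ (quotients i)) (λ _ → 0ℤ)
      z : Vector ℤ c
      z = proj₁ assembled
      Uv≗ : U · v ≗ U · A ᵀ · W · z
      Uv≗ k = trans (·-‿- x y k) (trans (torsion-free-elim ρ≤t
        (λ k → (U · x) k - (U · y) k ≡ (diag d · z) k)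
        (λ i → trans (proj₂ (quotients i))
          (trans (cong (_* ℤ.+ d i) (sym (proj₁ (proj₂ assembled) i)))
                 (sym (diag-torsion d ρ≤t ρ≤c z i))))
        (λ i → trans (ℤ.i≡j⇒i-j≡0 (free≈ i)) (sym (diag-free d ρ≤t ρ≤c z i)))
        k) (sym (UAᵀW· z k)))
      v≗ : ∀ j → v j ≡ ∑[ i < c ] ((W · z) i * A i j)
      v≗ j = trans (rightInverse⇒injective {M = U} {N = U⁻¹} U·U⁻¹· Uv≗ j)
                   (sum-cong-≗ λ i → ℤ.*-comm (A i j) ((W · z) i))

    smith-surjective : ∀ y → ∃ λ x → ∀ {z} → z Γuniv.≈ x → smith z Δ.≈ y
    smith-surjective (torsion , free) = U⁻¹ · v , λ {z} z≈x →
      Δ.trans {smith z} {smith (U⁻¹ · v)} {torsion , free} (⟦⟧-cong z≈x)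
        ((λ i → ≈⇒quotient≈ ℤ.+-0-abelianGroup (trans (U·U⁻¹· v _) (proj₁ (proj₂ assembled) i))) ,
         (λ i → trans (U·U⁻¹· v _) (proj₂ (proj₂ assembled) i)))
      where
      open IsHom Γuniv Δ smith-Γuniv-hom using (⟦⟧-cong)
      assembled = assemble ρ≤t torsion free
      v : Vector ℤ t
      v = proj₁ assembled

  smith-isomorphism : IsIso Γuniv Δ smith
  smith-isomorphism = record
    { isGroupMonomorphism = record
      { isGroupHomomorphism = smith-Γuniv-hom
      ; injective           = λ {x} {y} → smith-injective {x} {y}
      }
    ; surjective = smith-surjective
    }

  smith-basisVector : ∀ j → smith (basisVector j) Δ.≈
    ((λ i → U (torsionIndex ρ≤t i) j) , (λ i → U (freeIndex ρ≤t i) j))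
  smith-basisVector j =
    (λ i → ≈⇒quotient≈ ℤ.+-0-abelianGroup (·-basisVector U j (torsionIndex ρ≤t i))) ,
    (λ i → ·-basisVector U j (freeIndex ρ≤t i))

ℤ/1-trivial : ∀ {d} → d ≡ 1 → ∀ x → AbelianGroup._≈_ (ℤ/ d) x 0ℤ
ℤ/1-trivial refl x = ∈⟨⟩⇒quotient≈ε ℤ.+-0-abelianGroup x
  (resp (ℤ.*-identityʳ x) (multiple⇒∈⟨+d⟩ 1 x))

-- Walks

module _ (G : Graph) where
  open Graph G

  endpoint∈vertices : ∀ {u v} (w : Walk u v) → v ∈ vertices w
  endpoint∈vertices nil     = here refl
  endpoint∈vertices (_ ◅ w) = there (endpoint∈vertices w)

  -- The cut is at the first visit to `u`. Containment is stated as transport of `All`, the form in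
  -- which it keeps `before` simple during the recursion.
  record Split {x y} (p : Walk x y) (u : V) : Set₁ where
    field
      before        : Walk x u
      after         : Walk u y
      rejoin        : p ≡ before ◅◅ after
      before⊆p      : ∀ {Q : Pred V 0ℓ} → All Q (vertices p) → All Q (sources before)
      before-avoids : All (u ≢_) (sources before)
      before-simple : Unique (sources before)
      after-path    : IsPath after

  split : ∀ {x y} (p : Walk x y) → IsPath p → ∀ {u} → u ∈ vertices p → Split p u
  split {x} p p-path {u} u∈p with u ≟ x
  split p p-path u∈p | yes refl = record
    { before = nil ; after = p ; rejoin = refl ; before⊆p = λ _ → [] ; before-avoids = []
    ; before-simple = [] ; after-path = p-path }
  split nil _ (here u≡x) | no u≢x = contradiction u≡x u≢x
  split (e ◅ p) _ (here u≡x) | no u≢x = contradiction u≡x u≢x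
  split (e ◅ p) (x∉p ∷ p-path) (there u∈p) | no u≢x = record
    { before        = e ◅ before
    ; after         = after
    ; rejoin        = cong (e ◅_) rejoin
    ; before⊆p      = λ { (Qx ∷ Qp) → Qx ∷ before⊆p Qp }
    ; before-avoids = u≢x ∷ before-avoids
    ; before-simple = before⊆p x∉p ∷ before-simple
    ; after-path    = after-path
    }
    where open Split (split p p-path u∈p)

-- Path independence of signed sums for a consistent assignment

module _ {G : Graph} (𝒫 : OrientedPartition G t) (Γ : AbelianGroup a ℓ)
         {g : Vector (AbelianGroup.Carrier Γ) t} (consistent : OrientedPartition.Consistent 𝒫 Γ g) where
  open Graph G
  open OrientedPartition 𝒫
  private module Γ = AbelianGroup Γ
  open AbelianGroup Γ using (Carrier; _≈_; _∙_; ε; _⁻¹)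
  open AbelianGroupProperties Γ
  open SetoidReasoning Γ.setoid hiding (stop)

  private
    σ : ∀ {u v} → Walk u v → Carrier
    σ = signedSum Γ g

  label : ∀ {u v} → u ~ v → Carrier
  label e = if forward e then g (class e) else g (class e) ⁻¹

  backtrack≈ε : ∀ {u v} (e : u ~ v) → label e ∙ label (~-sym e) ≈ ε
  backtrack≈ε e rewrite class-sym e | forward-sym e with forward e
  ... | true  = Γ.inverseʳ _
  ... | false = Γ.inverseˡ _

  -- One edge would be a loop; two edges traverse the same edge back and forth, since edges are
  -- unique; three or more form a cycle, to which consistency applies.
  simpleClosedWalk≈ε : ∀ {u v} (e : u ~ v) (w : Walk v u) → Unique (sources (e ◅ w)) → σ (e ◅ w) ≈ ε
  simpleClosedWalk≈ε e nil              simple = contradiction e (~-irrefl refl)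
  simpleClosedWalk≈ε e (e′ ◅ nil)       simple rewrite ~-irrelevant e′ (~-sym e) =
    Γ.trans (Γ.∙-congˡ (Γ.identityʳ _)) (backtrack≈ε e)
  simpleClosedWalk≈ε e (e′ ◅ e″ ◅ w)    simple = consistent record
    { walk = e ◅ e′ ◅ e″ ◅ w ; simple = simple ; 3≤length = s≤s (s≤s (s≤s z≤n)) }

  -- The tail has already been erased to a path, so only the new source `u` can recur. If it does,
  -- `e` and the part of the path before that visit form a simple closed walk, which is discarded.
  loopErasure : ∀ {u v} (w : Walk u v) → ∃ λ (p : Walk u v) → IsPath p × σ w ≈ σ p
  loopErasure nil = nil , [] ∷ [] , Γ.refl
  loopErasure {u} (e ◅ w) with loopErasure w
  ... | p , p-path , σw≈σp with Any.any? (u ≟_) (vertices p)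
  ...   | no  u∉p = e ◅ p , ¬Any⇒All¬ _ u∉p ∷ p-path , Γ.∙-congˡ σw≈σp
  ...   | yes u∈p = after , after-path , (begin
      label e ∙ σ w                      ≈⟨ Γ.∙-congˡ σw≈σp ⟩
      label e ∙ σ p                      ≡⟨ cong (λ p → label e ∙ σ p) rejoin ⟩
      label e ∙ σ (before ◅◅ after)      ≈⟨ Γ.∙-congˡ (signedSum-◅◅ 𝒫 Γ g before after) ⟩
      label e ∙ (σ before ∙ σ after)     ≈⟨ Γ.assoc _ _ _ ⟨
      σ (e ◅ before) ∙ σ after           ≈⟨ Γ.∙-congʳ
        (simpleClosedWalk≈ε e before (before-avoids ∷ before-simple)) ⟩
      ε ∙ σ after                        ≈⟨ Γ.identityˡ _ ⟩
      σ after                            ∎)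
    where open Split (split G p p-path u∈p)

  -- A path from `u` to itself is empty, as otherwise its endpoint would repeat its start.
  closedWalk≈ε : ∀ {u} (w : Walk u u) → σ w ≈ ε
  closedWalk≈ε w with loopErasure w
  ... | nil   , _          , σw≈ε = σw≈ε
  ... | e ◅ p , u∉p ∷ _ , _    = contradiction refl (lookup u∉p (endpoint∈vertices G p))

  -- Both walks are closed up by one return walk `w″`, whose contribution then cancels.
  signedSum-pathIndependent : Connected → ∀ {u v} (w w′ : Walk u v) → σ w ≈ σ w′
  signedSum-pathIndependent connected {u} {v} w w′ = ∙-cancelʳ (σ w″) (σ w) (σ w′) (begin
    σ w ∙ σ w″       ≈⟨ signedSum-◅◅ 𝒫 Γ g w w″ ⟨
    σ (w ◅◅ w″)      ≈⟨ closedWalk≈ε (w ◅◅ w″) ⟩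
    ε                ≈⟨ closedWalk≈ε (w′ ◅◅ w″) ⟨
    σ (w′ ◅◅ w″)     ≈⟨ signedSum-◅◅ 𝒫 Γ g w′ w″ ⟩
    σ w′ ∙ σ w″      ∎)
    where
    w″ : Walk v u
    w″ = connected v u

  -- The induced labeling and walks in the Cayley graph

  module Labeling (connected : Connected) {r : V} (P : ∀ v → Walk r v) where
    open Cayley Γ (connectionSet Γ g)

    private
      φ : V → Carrier
      φ v = σ (P v)

    labeling-edge : ∀ {u v} (e : u ~ v) → φ v ≈ φ u ∙ label e
    labeling-edge {u} {v} e = begin
      φ v                       ≈⟨ signedSum-pathIndependent connected (P v) (P u ◅◅ e ◅ nil) ⟩
      σ (P u ◅◅ e ◅ nil)        ≈⟨ signedSum-◅◅ 𝒫 Γ g (P u) (e ◅ nil) ⟩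
      φ u ∙ (label e ∙ ε)       ≈⟨ Γ.∙-congˡ (Γ.identityʳ (label e)) ⟩
      φ u ∙ label e             ∎

    -- The connection set omits trivial generators, so an edge of such a class gives no Cayley step;
    -- instead it collapses to a point.
    trivialLabel : ∀ {u v} (e : u ~ v) → g (class e) ≈ ε → φ u ≈ φ v
    trivialLabel {u} {v} e gₑ≈ε = Γ.sym (begin
      φ v               ≈⟨ labeling-edge e ⟩
      φ u ∙ label e     ≈⟨ Γ.∙-congˡ (label≈ε (forward e)) ⟩
      φ u ∙ ε           ≈⟨ Γ.identityʳ (φ u) ⟩
      φ u               ∎)
      where
      label≈ε : ∀ s → (if s then g (class e) else g (class e) ⁻¹) ≈ ε
      label≈ε true  = gₑ≈ε
      label≈ε false = Γ.trans (Γ.⁻¹-cong gₑ≈ε) ε⁻¹≈ε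

    edge-adjacent : ∀ {u v} (e : u ~ v) → ¬ (g (class e) ≈ ε) → Adjacent (φ u) (φ v)
    edge-adjacent e gₑ≉ε =
      label e , (class e , gₑ≉ε , label-sign (forward e)) , inj₁ (labeling-edge e)
      where
      label-sign : ∀ s → let x = if s then g (class e) else g (class e) ⁻¹ in
                   x ≈ g (class e) ⊎ x ≈ g (class e) ⁻¹
      label-sign true  = inj₁ Γ.refl
      label-sign false = inj₂ Γ.refl

    -- By `trivialLabel`, distinct labels at the ends of an edge force its generator to be
    -- nontrivial. The tail is matched so that `vertices` exposes the next vertex, as `step`
    -- requires.
    lazyWalk : ∀ {u v} (w : Walk u v) → LazyWalk (map φ (vertices w)) (φ u) (φ v) (length w)
    lazyWalk nil          = stop Γ.refl
    lazyWalk (e ◅ nil)    = step (λ φu≉φv → edge-adjacent e (φu≉φv ∘ trivialLabel e)) (lazyWalk nil)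
    lazyWalk (e ◅ e′ ◅ w) = step (λ φu≉φv → edge-adjacent e (φu≉φv ∘ trivialLabel e)) (lazyWalk (e′ ◅ w))

    cayleyWalk : ∀ {u v} (w : Walk u v) → All (λ j → ¬ (g j ≈ ε)) (classes w) →
                 CayleyWalk (map φ (vertices w)) (φ u) (φ v) (length w)
    cayleyWalk nil          []             = stop Γ.refl
    cayleyWalk (e ◅ nil)    (gₑ≉ε ∷ gs≉ε) = step (edge-adjacent e gₑ≉ε) (cayleyWalk nil gs≉ε)
    cayleyWalk (e ◅ e′ ◅ w) (gₑ≉ε ∷ gs≉ε) = step (edge-adjacent e gₑ≉ε) (cayleyWalk (e′ ◅ w) gs≉ε)

    prependStep : ∀ {x y z xs n} → Adjacent x y → CayleyWalk xs y z n → ∃ λ xs′ → CayleyWalk xs′ x z (suc n)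
    prependStep s w@(stop _)   = _ , step s w
    prependStep s w@(step _ _) = _ , step s w

    replaceStart : ∀ {x y z xs n} → x ≈ y → CayleyWalk xs y z n → ∃ λ xs′ → CayleyWalk xs′ x z n
    replaceStart x≈y (stop y≈z) = _ , stop (Γ.trans x≈y y≈z)
    replaceStart x≈y (step (s , s∈S , inj₁ z≈ys) w) =
      _ , step (s , s∈S , inj₁ (Γ.trans z≈ys (Γ.∙-congʳ (Γ.sym x≈y)))) w
    replaceStart x≈y (step (s , s∈S , inj₂ y≈zs) w) =
      _ , step (s , s∈S , inj₂ (Γ.trans x≈y y≈zs)) w

    -- Edges with trivial generator are skipped and the others kept. Triviality in `Γ` is undecided,
    -- so the case distinction is available only under double negation.
    shortenedCayleyWalk : ∀ {u v} (w : Walk u v) →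
      ¬ ¬ ∃ λ k → k ≤ length w × ∃ λ xs → CayleyWalk xs (φ u) (φ v) k
    shortenedCayleyWalk nil ¬walk = ¬walk (0 , z≤n , _ , stop Γ.refl)
    shortenedCayleyWalk (e ◅ w) ¬walk = shortenedCayleyWalk w λ { (k , k≤∣w∣ , _ , w′) →
      -- A trivial generator is refuted first: the walk for the tail, moved to start at `φ u`, would
      -- already contradict `¬walk`. The edge therefore gives a genuine step.
      ¬walk (suc k , s≤s k≤∣w∣ , prependStep (edge-adjacent e λ gₑ≈ε →
        ¬walk (k , ℕ.m≤n⇒m≤1+n k≤∣w∣ , replaceStart (trivialLabel e gₑ≈ε) w′)) w′) }

-- Well-foundedness of `_<_`: a member with no smaller member would be least, so without a least
-- member strong induction excludes every number. As `P` is undecided, the conclusion is doubly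
-- negated.
¬¬-least : ∀ (P : Pred ℕ p) {n} → P n → ¬ ¬ ∃ (IsLeast P)
¬¬-least P {n} Pn ¬least = <-rec (λ n → ¬ P n) (λ n ¬P< Pn →
  ¬least (n , Pn , λ k Pk → ℕ.≮⇒≥ λ k<n → ¬P< k<n Pk)) n Pn

theorem3p12 :
  ∀ {a ℓ} (G : Graph) → let open Graph G in
  Connected →
  ∀ {t} (𝒫 : OrientedPartition G t) → let open OrientedPartition 𝒫 in
  ∀ {c} (B : Vector Cycle c) → IsCycleBasis B →
  let
    A : Matrix c t
    A = cycleClassMatrix B
    Γuniv = ℤ^t/rowlattice A
    open AbelianGroup Γuniv using (Carrier)
    open AbelianGroup Γuniv using (_≈_)
    open AbelianGroup Γuniv using (ε)
    g : Vector Carrier t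
    g = basisVector
  in
  -- (i)
  ( Consistent Γuniv g
  × Generates Γuniv g
  × (∀ (Γ : AbelianGroup a ℓ) (g′ : Vector (AbelianGroup.Carrier Γ) t) →
       Consistent Γ g′ → IsHomomorphicImage Γuniv Γ g g′)
  )
  ×
  -- (ii)
  (∀ {ρ} → IsRank A ρ →
   ∀ (ρ≤t : ρ ≤ t) → ρ ≤ c →
   ∀ (U : Matrix t t) (W : Matrix c c) (d : Vector ℕ ρ) →
   Unimodular U → Unimodular W → U ⊗ A ᵀ ⊗ W ≋ diag d →
   let
     Δ = Π (λ i → ℤ/ (d i)) ×ᴳ ℤ^ (t ∸ ρ)
   in
   (∃ λ f → IsIso Γuniv Δ f
          × (∀ j → AbelianGroup._≈_ Δ (f (g j))
               ((λ i → U (torsionIndex ρ≤t i) j) , (λ i → U (freeIndex ρ≤t i) j))))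
   × (∀ i → d i ≡ 1 →
        ∀ x → AbelianGroup._≈_ (ℤ/ (d i)) x (AbelianGroup.ε (ℤ/ (d i))))
  )
  ×
  -- (iii)
  (∀ (r : V) (P : ∀ v → Walk r v) → (∀ v → IsPath (P v)) →
   let
     φ : V → Carrier
     φ v = signedSum Γuniv g (P v)
     open Cayley Γuniv (connectionSet Γuniv g)
   in
   (∀ {u v} (w : Walk u v) → IsPath w →
      LazyWalk (map φ (vertices w)) (φ u) (φ v) (length w)
      × (All (λ j → ¬ (g j ≈ ε)) (classes w) →
           CayleyWalk (map φ (vertices w)) (φ u) (φ v) (length w)))
   × (∀ u v n → IsDistance G u v n →
        ¬ ¬ (∃ λ m → IsCayleyDistance (φ u) (φ v) m)
        × (∀ m → IsCayleyDistance (φ u) (φ v) m →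
             m ≤ n × (m ≢ n → m < n)))
  )
theorem3p12 G connected {t} 𝒫 {c} B basis =
  ( basisVector-consistent 𝒫 basis
  , basisVector-generates (cycleClassMatrix B)
  , λ Γ g′ → universal 𝒫 B Γ
  ) ,
  (λ _ ρ≤t ρ≤c U W d U-unimodular W-unimodular UAᵀW≋diag →
    let module Smith = SmithNormalForm {A = cycleClassMatrix B} ρ≤t ρ≤c {U} {W} d
                         U-unimodular W-unimodular UAᵀW≋diag
    in (Smith.smith , Smith.smith-isomorphism , Smith.smith-basisVector) , λ i → ℤ/1-trivial) ,
  λ r P _ →
    let open Labeling 𝒫 (ℤ^t/rowlattice (cycleClassMatrix B)) (basisVector-consistent 𝒫 basis) connected P
    in (λ w _ → lazyWalk w , cayleyWalk w) ,
       λ { u v n ((w , refl) , _) →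
         (λ ¬distance → shortenedCayleyWalk w λ (k , _ , walk) → ¬¬-least _ walk ¬distance) ,
         λ m (_ , m-least) →
           -- The order on ℕ is decidable, so the double negation around the shortened walk can be
           -- removed from this inequality.
           let m≤n = decidable-stable (m ℕ.≤? length w) λ m≰n →
                       shortenedCayleyWalk w λ (k , k≤n , walk) → m≰n (ℕ.≤-trans (m-least k walk) k≤n)
           in m≤n , ℕ.≤∧≢⇒< m≤n }
  where
  open Graph G
  open OrientedPartition 𝒫
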